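{- There exist functions $r(n)=s(n)=t(n)=\Theta(\log n)$ such that the following holds. Let $G=G_{n,r,s,t}$ with these parameters, let $M$ be the number of edges of $G$, and let $B_0$ be any tree of $G$ consisting entirely of zero-edges. If $\sigma$ is a uniformly random bijection $E\to\{1,\dots,|E|\}$, then the expected number of improving switches performed by $\textsc{Random-Facet}^{1P}(E,B_0,\sigma)$ is at least $e^{\Omega(\sqrt{n})}=e^{\Omega(\sqrt{M}/\log^{3/2}M)}$.
   Context: The graph $G_{n,r,s,t}=(V,E,c)$, for positive integers $n,r,s,t$ and $\epsilon=1/(rs)$: the vertex set consists of a target $\mathsf{t}$, vertices $u_i,w_i$ ($i\in[n]$), $a_{i,j,k}$ ($i\in[n],j\in[r],k\in[s]$) and $b_{i,j}$ ($i\in[n],j\in[rs]$); write $u_{n+1}=w_{n+1}=\mathsf{t}$. The edges (all distinct elements of $E$, even when parallel) are, for $i\in[n]$ and $\ell\in[t]$: $a^1_{i,j,k}:a_{i,j,k}\to a_{i,j,k+1}$ of cost $0$ ($j\in[r],k\in[s-1]$); $a^1_{i,j,s}:a_{i,j,s}\to b_{i,1}$ of cost $0$; $a^{0,\ell}_{i,j,k}:a_{i,j,k}\to u_{i+1}$ of cost $2^{2i+1}+(k-1)\epsilon$ ($j\in[r],k\in[s]$); $b^1_{i,j}:b_{i,j}\to b_{i,j+1}$ of cost $0$ ($j\in[rs-1]$); $b^1_{i,rs}:b_{i,rs}\to w_{i+1}$ of cost $0$; $b^{0,\ell}_{i,j}:b_{i,j}\to u_{i+1}$ of cost $2^{2i+1}+1+(j-1)\epsilon$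 ($j\in[rs]$); $u^{1,\ell}_i:u_i\to b_{i,1}$ of cost $0$; $u^{0,\ell}_i:u_i\to u_{i+1}$ of cost $2^{2i}$; $w^{j,\ell}_i:w_i\to a_{i,j,1}$ of cost $0$ ($j\in[r]$); $w^{0,\ell}_i:w_i\to w_{i+1}$ of cost $2^{2i}$. The graph is acyclic. The edges named $a^{0,\ell}_{i,j,k},b^{0,\ell}_{i,j},u^{0,\ell}_i,w^{0,\ell}_i$ are called zero-edges. A tree is a set $B\subseteq E$ containing exactly one edge leaving each vertex other than $\mathsf{t}$. For a tree $B$ and vertex $u$, $y_B(u)$ is the total cost of the path from $u$ to $\mathsf{t}$ using edges of $B$. An edge $e=(u,v)$ is an improving switch with respect to $B$ if $c(e)+y_B(v)<y_B(u)$; then $B[e]$ denotes the tree obtained from $B$ by replacing the edge leaving $u$ by $e$. $\textsc{Random-Facet}^{1P}(F,B,\sigma)$, for $B\subseteq F\subseteq E$ with $B$ a tree and $\sigma$ an injective map $E\to\mathbb{N}$: if $F=B$ return $B$. Otherwise let $e$ be the edge of $F\setminus B$ with smallest $\sigma(e)$, let $B'=\textsc{Random-Facet}^{1P}(F\setminus\{e\},B,\sigma)$; if $e$ is an improving switch with respect to $B'$, perform it and return $\textsc{Random-Facet}^{1P}(F,B'[e],\sigma)$, otherwise return $B'$. The number of improving switches performed counts all switches $B'\mapsto B'[e]$ over all recursive calls. -}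

module Defs where

open import Data.Nat as ℕ using (ℕ; zero; suc; _<?_; NonZero; _≡ᵇ_)
open import Data.Nat.Properties using (m*n≢0)
open import Data.Fin using (Fin; toℕ; fromℕ<; zero)
open import Data.Bool using (Bool; true; false; _∧_; not; if_then_else_)
open import Data.List using (List; []; _∷_; [_]; map; concatMap; allFin)
open import Data.List.Membership.Propositional using (_∈_)
open import Data.Maybe using (Maybe; just; nothing)
open import Data.Product using (Σ; ∃; _×_; _,_)
open import Data.Integer using (+_)
open import Data.Rational using (ℚ; _+_; _<_; 0ℚ; _/_)
open import Relation.Binary.PropositionalEquality using (_≡_; _≢_)
open import Relation.Nullary using (¬_; yes; no)

-- All orderings (permutations) of a list.  A bijection σ : E → {1..|E|}
-- is represented by the list of edges sorted by increasing σ-value.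

insertions : {A : Set} → A → List A → List (List A)
insertions x []       = [ x ∷ [] ]
insertions x (y ∷ ys) = (x ∷ y ∷ ys) ∷ map (y ∷_) (insertions x ys)

perms : {A : Set} → List A → List (List A)
perms []       = [ [] ]
perms (x ∷ xs) = concatMap (insertions x) (perms xs)

eqFin : {m : ℕ} → Fin m → Fin m → Bool
eqFin i j = toℕ i ≡ᵇ toℕ j

-- The graph G_{n,r,s,t}.  Indices are 0-based: Fin n index i stands for
-- the paper's index i+1, and likewise for j, k, ℓ.

module Graph (n r s t : ℕ) .{{r≢0 : NonZero r}} .{{s≢0 : NonZero s}} where

  data V : Set where
    tgt : V
    u w : Fin n → V
    a   : Fin n → Fin r → Fin s → V
    b   : Fin n → Fin (r ℕ.* s) → V

  -- u_m, w_m for a 0-based index m, with u_n = w_n = t (paper: u_{n+1}=w_{n+1}=t)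
  uAt : ℕ → V
  uAt m with m <? n
  ... | yes p = u (fromℕ< p)
  ... | no _  = tgt

  wAt : ℕ → V
  wAt m with m <? n
  ... | yes p = w (fromℕ< p)
  ... | no _  = tgt

  bAt : Fin n → ℕ → V
  bAt i m with m <? r ℕ.* s
  ... | yes p = b i (fromℕ< p)
  ... | no _  = wAt (suc (toℕ i))

  aAt : Fin n → Fin r → ℕ → V
  aAt i j m with m <? s
  ... | yes p = a i j (fromℕ< p)
  ... | no _  = bAt i 0

  data Ed : Set where
    a1 : Fin n → Fin r → Fin s → Ed
    a0 : Fin n → Fin r → Fin s → Fin t → Ed
    b1 : Fin n → Fin (r ℕ.* s) → Ed
    b0 : Fin n → Fin (r ℕ.* s) → Fin t → Ed
    u1 : Fin n → Fin t → Ed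
    u0 : Fin n → Fin t → Ed
    wj : Fin n → Fin r → Fin t → Ed
    w0 : Fin n → Fin t → Ed

  tail : Ed → V
  tail (a1 i j k)   = a i j k
  tail (a0 i j k l) = a i j k
  tail (b1 i j)     = b i j
  tail (b0 i j l)   = b i j
  tail (u1 i l)     = u i
  tail (u0 i l)     = u i
  tail (wj i j l)   = w i
  tail (w0 i l)     = w i

  head : Ed → V
  head (a1 i j k)   = aAt i j (suc (toℕ k))
  head (a0 i j k l) = uAt (suc (toℕ i))
  head (b1 i j)     = bAt i (suc (toℕ j))
  head (b0 i j l)   = uAt (suc (toℕ i))
  head (u1 i l)     = bAt i 0
  head (u0 i l)     = uAt (suc (toℕ i))
  head (wj i j l)   = aAt i j 0
  head (w0 i l)     = wAt (suc (toℕ i))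

  nat : ℕ → ℚ
  nat m = (+ m) / 1

  timesε : ℕ → ℚ
  timesε m = _/_ (+ m) (r ℕ.* s) {{m*n≢0 r s}}

  -- paper's index i (1-based) is suc (toℕ i)
  cost : Ed → ℚ
  cost (a1 i j k)   = 0ℚ
  cost (a0 i j k l) = nat (2 ℕ.^ (2 ℕ.* suc (toℕ i) ℕ.+ 1)) + timesε (toℕ k)
  cost (b1 i j)     = 0ℚ
  cost (b0 i j l)   = nat (2 ℕ.^ (2 ℕ.* suc (toℕ i) ℕ.+ 1) ℕ.+ 1) + timesε (toℕ j)
  cost (u1 i l)     = 0ℚ
  cost (u0 i l)     = nat (2 ℕ.^ (2 ℕ.* suc (toℕ i)))
  cost (wj i j l)   = 0ℚ
  cost (w0 i l)     = nat (2 ℕ.^ (2 ℕ.* suc (toℕ i)))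

  isZeroEdge : Ed → Bool
  isZeroEdge (a0 _ _ _ _) = true
  isZeroEdge (b0 _ _ _)   = true
  isZeroEdge (u0 _ _)     = true
  isZeroEdge (w0 _ _)     = true
  isZeroEdge _            = false

  eqV : V → V → Bool
  eqV tgt tgt = true
  eqV (u i) (u i') = eqFin i i'
  eqV (w i) (w i') = eqFin i i'
  eqV (a i j k) (a i' j' k') = eqFin i i' ∧ eqFin j j' ∧ eqFin k k'
  eqV (b i j) (b i' j') = eqFin i i' ∧ eqFin j j'
  eqV _ _ = false

  eqE : Ed → Ed → Bool
  eqE (a1 i j k) (a1 i' j' k') = eqFin i i' ∧ eqFin j j' ∧ eqFin k k'
  eqE (a0 i j k l) (a0 i' j' k' l') = eqFin i i' ∧ eqFin j j' ∧ eqFin k k' ∧ eqFin l l'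
  eqE (b1 i j) (b1 i' j') = eqFin i i' ∧ eqFin j j'
  eqE (b0 i j l) (b0 i' j' l') = eqFin i i' ∧ eqFin j j' ∧ eqFin l l'
  eqE (u1 i l) (u1 i' l') = eqFin i i' ∧ eqFin l l'
  eqE (u0 i l) (u0 i' l') = eqFin i i' ∧ eqFin l l'
  eqE (wj i j l) (wj i' j' l') = eqFin i i' ∧ eqFin j j' ∧ eqFin l l'
  eqE (w0 i l) (w0 i' l') = eqFin i i' ∧ eqFin l l'
  eqE _ _ = false

  allEdges : List Ed
  allEdges =
    concatMap (λ i →
         concatMap (λ j → map (a1 i j) (allFin s)) (allFin r)
      Data.List.++ concatMap (λ j → concatMap (λ k → map (a0 i j k) (allFin t)) (allFin s)) (allFin r)
      Data.List.++ map (b1 i) (allFin (r ℕ.* s))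
      Data.List.++ concatMap (λ j → map (b0 i j) (allFin t)) (allFin (r ℕ.* s))
      Data.List.++ map (u1 i) (allFin t)
      Data.List.++ map (u0 i) (allFin t)
      Data.List.++ concatMap (λ j → map (wj i j) (allFin t)) (allFin r)
      Data.List.++ map (w0 i) (allFin t))
    (allFin n)

  EdgeSet : Set
  EdgeSet = Ed → Bool

  -- B is a tree: exactly one edge of B leaves each vertex other than t
  -- (no edge leaves t at all in G).
  IsTree : EdgeSet → Set
  IsTree B = ∀ v → v ≢ tgt →
    Σ Ed λ e → (B e ≡ true) × (tail e ≡ v) ×
      (∀ e' → B e' ≡ true → tail e' ≡ v → e' ≡ e)

  findFirst : (Ed → Bool) → List Ed → Maybe Ed
  findFirst p [] = nothing
  findFirst p (e ∷ es) = if p e then just e else findFirst p es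

  outEdge : EdgeSet → V → Maybe Ed
  outEdge B v = findFirst (λ e → B e ∧ eqV (tail e) v) allEdges

  numV : ℕ
  numV = 1 ℕ.+ 2 ℕ.* n ℕ.+ 2 ℕ.* (n ℕ.* (r ℕ.* s))

  yFuel : EdgeSet → ℕ → V → ℚ
  yFuel B zero v = 0ℚ
  yFuel B (suc f) v with outEdge B v
  ... | nothing = 0ℚ
  ... | just e  = cost e + yFuel B f (head e)

  -- y_B(v): G is acyclic, so every B-path has fewer than numV edges
  y : EdgeSet → V → ℚ
  y B v = yFuel B numV v

  Improving : EdgeSet → Ed → Set
  Improving B e = cost e + y B (head e) < y B (tail e)

  switch : EdgeSet → Ed → EdgeSet
  switch B e e' = if eqV (tail e') (tail e) then eqE e' e else B e'

  remove : EdgeSet → Ed → EdgeSet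
  remove F e e' = F e' ∧ not (eqE e' e)

  firstOut : List Ed → EdgeSet → EdgeSet → Maybe Ed
  firstOut ord F B = findFirst (λ e → F e ∧ not (B e)) ord

  -- Big-step semantics of Random-Facet^{1P}:
  -- RF ord F B B' k  ⇔  Random-Facet^{1P}(F,B,σ) returns B' after
  -- performing k improving switches in total.
  data RF (ord : List Ed) : EdgeSet → EdgeSet → EdgeSet → ℕ → Set where
    done : ∀ {F B} → (∀ e → F e ≡ B e) → RF ord F B B 0
    skip : ∀ {F B B' e k} → firstOut ord F B ≡ just e →
           RF ord (remove F e) B B' k → ¬ Improving B' e →
           RF ord F B B' k
    take : ∀ {F B B' B'' e k k'} → firstOut ord F B ≡ just e →
           RF ord (remove F e) B B' k → Improving B' e →
           RF ord F (switch B' e) B'' k' →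
           RF ord F B B'' (k ℕ.+ suc k')

  fullSet : EdgeSet
  fullSet _ = true

  orderings : List (List Ed)
  orderings = perms allEdges

module Submission where

-- Idea.  Random-Facet returns a shortest-path tree of F, so the run is governed by the shortest
-- distances in the shrinking edge sets.  Call level i set when all edges b¹ᵢⱼ are available.  If y(uᵢ₊₁) =
-- y(wᵢ₊₁), a set level with a complete chain of a's passes that equality on, and so does an unset level; but
-- right after the last b-edge of level i is inserted, uᵢ is cheap while wᵢ is not, because every chain
-- of a's still misses an early edge.  This gap drives all lower levels back to their zero-edges before wᵢ
-- catches up, and then the lower levels count again.  Hence, if levels d₁ > d₂ > … > d_q have their first b-edges
-- in this order, each of the 2^q subsets contributes a switch: at least 2^q - 1 in total.
--
-- Such behaviour needs an ordering in which every bundle of t copies has a member after the first edge of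
-- each chain, and in which some chain of level i lies entirely after the first b-edge of that level.
-- Each instance of these conditions fails with probability at most 2^-t (r = s = t), since failure fixes the outcome of t
-- comparisons that can be flipped independently by exchanging edges.  By Erdős–Szekeres the first
-- b-edges of the n levels contain a monotone subsequence of length √n, and reversing the order of the levels
-- makes it decreasing in the ordering or in its mirror image.

open import Defs
open import Data.Bool using (Bool; true; false; _∧_; not; if_then_else_; T)
import Data.Bool as Bool
open import Data.Empty using (⊥; ⊥-elim)
open import Data.Fin using (Fin; zero; suc; toℕ; fromℕ<; combine; remQuot; opposite)
import Data.Fin as Fin
import Data.Fin.Properties as Fin
import Data.Integer as ℤ
import Data.Integer.Properties as ℤ
open import Data.List
  using (List; []; _∷_; [_]; _++_; map; concat; concatMap; length; lookup; reverse; tabulate; allFin)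
open import Data.List.Membership.Propositional using (_∈_; lose; find)
open import Data.List.Membership.Propositional.Properties
open import Data.List.Membership.Propositional.Properties.WithK using (unique∧set⇒bag)
open import Data.List.Properties
  using (++-identityʳ; concatMap-cong; map-∘; map-++; length-map; length-++; length-tabulate; length-reverse; unfold-reverse)
open import Data.List.Relation.Binary.BagAndSetEquality using (∼bag⇒↭)
open import Data.List.Relation.Binary.Disjoint.Propositional using (Disjoint)
open import Data.List.Relation.Binary.Permutation.Propositional as ↭
  using (_↭_; prep; swap; ↭-refl; ↭-trans; ↭-sym)
open import Data.List.Relation.Binary.Permutation.Propositional.Properties using (∈-resp-↭; ↭-reverse)
open import Data.List.Relation.Unary.All using (All; []; _∷_)
import Data.List.Relation.Unary.All as All
import Data.List.Relation.Unary.All.Properties as All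
open import Data.List.Relation.Unary.AllPairs using (AllPairs; []; _∷_)
import Data.List.Relation.Unary.AllPairs as AllPairs
import Data.List.Relation.Unary.AllPairs.Properties as AllPairs
open import Data.List.Relation.Unary.Any using (here; there; satisfied)
open import Data.List.Relation.Unary.Unique.Propositional using (Unique)
import Data.List.Relation.Unary.Unique.Propositional.Properties as Unique
open import Data.Maybe using (just; nothing)
open import Data.Nat
open import Data.Nat.DivMod using (m/n*n≤m)
open import Data.Nat.ListAction using (sum)
open import Data.Nat.ListAction.Properties using (sum-++)
open import Data.Nat.Logarithm using (⌊log₂_⌋; ⌊log₂⌋-mono-≤; ⌊log₂[2^n]⌋≡n)
open import Data.Nat.Properties
open import Data.Nat.Solver using (module +-*-Solver)
open import Data.Product using (Σ; ∃; ∃₂; _×_; _,_; proj₁; proj₂)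
open import Data.Rational using (ℚ; toℚᵘ)
import Data.Rational as ℚ
import Data.Rational.Properties as ℚ
open import Data.Rational.Unnormalised as ℚᵘ using (mkℚᵘ; *≡*; *<*)
import Data.Rational.Unnormalised.Properties as ℚᵘ
open import Data.Sum using (_⊎_; inj₁; inj₂)
import Data.Sum as Sum
open import Data.Unit using (tt)
open import Function using (_∘_; flip; mk⇔)
open import Relation.Binary using (Transitive; tri<; tri≈; tri>)
open import Relation.Binary.PropositionalEquality hiding ([_])
open import Relation.Nullary
open import Relation.Nullary.Decidable using (_×-dec_)


-- The doubling comes from the recursion itself. Edges are set aside in increasing position and come
-- back in reverse, so the first b-edge of d₁ leaves before any of d₂, ..., d_q: the inner call
-- counts on the lower levels without it, its return is a switch, and the outer call counts on them
-- once more. The obstacle is that the outer call starts with the lower levels still set. It stays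
-- in a separate phase (`Pending`) until a call is reached whose removed edge breaks the last chain
-- of d₁; the optimal tree returned by the inner call of that one has the gap, hence reset lower
-- levels (`restart`). In between, unrelated edges leave and return in an unknown order, so no tree
-- is ever described completely. A needed switch is obtained by showing that otherwise the returned
-- tree would be optimal for a set whose optimal trees must contain the edge. The equality at the
-- level above has to survive all these calls; it does, because both its values are already minimal
-- over all trees inside F (`Lock`).

-- Fractions with a common denominator

module Fractions where

  open import Data.Integer using (+_; +<+)

  infix 8 _÷_
  _÷_ : ℕ → (d : ℕ) .{{_ : NonZero d}} → ℚ
  m ÷ d = (+ m) ℚ./ d

  ÷-+ : ∀ d .{{_ : NonZero d}} m n → (m + n) ÷ d ≡ m ÷ d ℚ.+ n ÷ d
  ÷-+ d@(suc d-1) m n = ℚ.toℚᵘ-injective (begin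
    toℚᵘ ((m + n) ÷ d)                      ≈⟨ ℚ.toℚᵘ-fromℚᵘ (mkℚᵘ (+ (m + n)) d-1) ⟩
    mkℚᵘ (+ (m + n)) d-1                    ≈⟨ *≡* eq ⟩
    mkℚᵘ (+ m) d-1 ℚᵘ.+ mkℚᵘ (+ n) d-1      ≈⟨ ℚᵘ.+-cong (ℚ.toℚᵘ-fromℚᵘ (mkℚᵘ (+ m) d-1)) (ℚ.toℚᵘ-fromℚᵘ (mkℚᵘ (+ n) d-1)) ⟨
    toℚᵘ (m ÷ d) ℚᵘ.+ toℚᵘ (n ÷ d)          ≈⟨ ℚ.toℚᵘ-homo-+ (m ÷ d) (n ÷ d) ⟨
    toℚᵘ (m ÷ d ℚ.+ n ÷ d)                  ∎)
    where
    open ℚᵘ.≃-Reasoning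
    eq : + (m + n) ℤ.* + (d * d) ≡ (+ m ℤ.* + d ℤ.+ + n ℤ.* + d) ℤ.* + d
    eq = trans (sym (ℤ.*-assoc (+ (m + n)) (+ d) (+ d)))
               (cong (ℤ._* + d) (ℤ.*-distribʳ-+ (+ d) (+ m) (+ n)))

  -- Integral costs are also put over the denominator `r * s`, so that comparing path costs becomes
  -- a comparison of natural numbers.
  ÷-integer : ∀ d .{{_ : NonZero d}} m → m ÷ 1 ≡ (d * m) ÷ d
  ÷-integer d@(suc d-1) m = ℚ.fromℚᵘ-cong {mkℚᵘ (+ m) 0} {mkℚᵘ (+ (d * m)) d-1} (*≡* eq)
    where
    eq : + m ℤ.* + d ≡ + (d * m) ℤ.* + 1
    eq = trans (ℤ.*-comm (+ m) (+ d)) (trans (sym (ℤ.pos-* d m)) (sym (ℤ.*-identityʳ _)))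

  ÷-mono-< : ∀ d .{{_ : NonZero d}} {m n} → m < n → m ÷ d ℚ.< n ÷ d
  ÷-mono-< d@(suc d-1) {m} {n} m<n = ℚ.toℚᵘ-cancel-<
    (ℚᵘ.<-respˡ-≃ (ℚᵘ.≃-sym (ℚ.toℚᵘ-fromℚᵘ (mkℚᵘ (+ m) d-1)))
    (ℚᵘ.<-respʳ-≃ (ℚᵘ.≃-sym (ℚ.toℚᵘ-fromℚᵘ (mkℚᵘ (+ n) d-1)))
      (*<* (ℤ.*-monoʳ-<-pos (+ d) (+<+ m<n)))))

  ÷-cancel-< : ∀ d .{{_ : NonZero d}} {m n} → m ÷ d ℚ.< n ÷ d → m < n
  ÷-cancel-< d@(suc d-1) {m} {n} lt = ℤ.drop‿+<+ (ℤ.*-cancelʳ-<-nonNeg (+ d) (drop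
    (ℚᵘ.<-respˡ-≃ (ℚ.toℚᵘ-fromℚᵘ (mkℚᵘ (+ m) d-1))
    (ℚᵘ.<-respʳ-≃ (ℚ.toℚᵘ-fromℚᵘ (mkℚᵘ (+ n) d-1)) (ℚ.toℚᵘ-mono-< lt)))))
    where
    drop : mkℚᵘ (+ m) d-1 ℚᵘ.< mkℚᵘ (+ n) d-1 → + m ℤ.* + d ℤ.< + n ℤ.* + d
    drop (*<* p) = p

open Fractions using (_÷_; ÷-+; ÷-integer; ÷-mono-<; ÷-cancel-<)

-- Decidable equality and the enumeration of edges

∧-true : ∀ {x y} → x ∧ y ≡ true → (x ≡ true) × (y ≡ true)
∧-true {true} {true} _ = refl , refl

∧-intro : ∀ {x y} → x ≡ true → y ≡ true → x ∧ y ≡ true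
∧-intro refl refl = refl

≡ᵇ-refl : ∀ m → (m ≡ᵇ m) ≡ true
≡ᵇ-refl zero    = refl
≡ᵇ-refl (suc m) = ≡ᵇ-refl m

eqFin-refl : ∀ {m} (i : Fin m) → eqFin i i ≡ true
eqFin-refl i = ≡ᵇ-refl (toℕ i)

eqFin-sound : ∀ {m} {i j : Fin m} → eqFin i j ≡ true → i ≡ j
eqFin-sound {i = i} {j} eq = Fin.toℕ-injective (≡ᵇ⇒≡ (toℕ i) (toℕ j) (subst T (sym eq) tt))

in-map : ∀ {A : Set} {m} (f : Fin m → A) k → f k ∈ map f (allFin m)
in-map f k = ∈-map⁺ f (∈-allFin k)

in-concatMap : ∀ {A : Set} {m} (f : Fin m → List A) k {x} → x ∈ f k → x ∈ concatMap f (allFin m)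
in-concatMap f k x∈ = ∈-concatMap⁺ f (lose (∈-allFin k) x∈)

module GraphFacts (n r s t : ℕ) .{{r≢0 : NonZero r}} .{{s≢0 : NonZero s}} where

  open Graph n r s t {{r≢0}} {{s≢0}} public

  eqE-refl : ∀ e → eqE e e ≡ true
  eqE-refl (a1 i j k)   = ∧-intro (eqFin-refl i) (∧-intro (eqFin-refl j) (eqFin-refl k))
  eqE-refl (a0 i j k l) = ∧-intro (eqFin-refl i) (∧-intro (eqFin-refl j) (∧-intro (eqFin-refl k) (eqFin-refl l)))
  eqE-refl (b1 i j)     = ∧-intro (eqFin-refl i) (eqFin-refl j)
  eqE-refl (b0 i j l)   = ∧-intro (eqFin-refl i) (∧-intro (eqFin-refl j) (eqFin-refl l))
  eqE-refl (u1 i l)     = ∧-intro (eqFin-refl i) (eqFin-refl l)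
  eqE-refl (u0 i l)     = ∧-intro (eqFin-refl i) (eqFin-refl l)
  eqE-refl (wj i j l)   = ∧-intro (eqFin-refl i) (∧-intro (eqFin-refl j) (eqFin-refl l))
  eqE-refl (w0 i l)     = ∧-intro (eqFin-refl i) (eqFin-refl l)

  private
    split₂ : ∀ {m m'} (i i' : Fin m) (j j' : Fin m') → eqFin i i' ∧ eqFin j j' ≡ true → (i ≡ i') × (j ≡ j')
    split₂ i i' j j' eq = eqFin-sound (proj₁ (∧-true {eqFin i i'} eq)) , eqFin-sound (proj₂ (∧-true {eqFin i i'} eq))

    split₃ : ∀ {m m' m''} (i i' : Fin m) (j j' : Fin m') (k k' : Fin m'') →
             eqFin i i' ∧ eqFin j j' ∧ eqFin k k' ≡ true → (i ≡ i') × (j ≡ j') × (k ≡ k')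
    split₃ i i' j j' k k' eq = eqFin-sound (proj₁ (∧-true {eqFin i i'} eq)) , split₂ j j' k k' (proj₂ (∧-true {eqFin i i'} eq))

  eqE-sound : ∀ e e' → eqE e e' ≡ true → e ≡ e'
  eqE-sound (a1 i j k) (a1 i' j' k') eq with refl , refl , refl ← split₃ i i' j j' k k' eq = refl
  eqE-sound (a0 i j k l) (a0 i' j' k' l') eq
    with refl ← eqFin-sound {i = i} {i'} (proj₁ (∧-true {eqFin i i'} eq))
       | refl , refl , refl ← split₃ j j' k k' l l' (proj₂ (∧-true {eqFin i i'} eq)) = refl
  eqE-sound (b1 i j) (b1 i' j') eq with refl , refl ← split₂ i i' j j' eq = refl
  eqE-sound (b0 i j l) (b0 i' j' l') eq with refl , refl , refl ← split₃ i i' j j' l l' eq = refl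
  eqE-sound (u1 i l) (u1 i' l') eq with refl , refl ← split₂ i i' l l' eq = refl
  eqE-sound (u0 i l) (u0 i' l') eq with refl , refl ← split₂ i i' l l' eq = refl
  eqE-sound (wj i j l) (wj i' j' l') eq with refl , refl , refl ← split₃ i i' j j' l l' eq = refl
  eqE-sound (w0 i l) (w0 i' l') eq with refl , refl ← split₂ i i' l l' eq = refl

  eqV-refl : ∀ v → eqV v v ≡ true
  eqV-refl tgt       = refl
  eqV-refl (u i)     = eqFin-refl i
  eqV-refl (w i)     = eqFin-refl i
  eqV-refl (a i j k) = ∧-intro (eqFin-refl i) (∧-intro (eqFin-refl j) (eqFin-refl k))
  eqV-refl (b i j)   = ∧-intro (eqFin-refl i) (eqFin-refl j)

  eqV-sound : ∀ v v' → eqV v v' ≡ true → v ≡ v'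
  eqV-sound tgt tgt eq = refl
  eqV-sound (u i) (u _) eq = cong u (eqFin-sound eq)
  eqV-sound (w i) (w _) eq = cong w (eqFin-sound eq)
  eqV-sound (a i j k) (a i' j' k') eq with refl , refl , refl ← split₃ i i' j j' k k' eq = refl
  eqV-sound (b i j) (b i' j') eq with refl , refl ← split₂ i i' j j' eq = refl

  _≟E_ : (e e' : Ed) → Dec (e ≡ e')
  e ≟E e' with eqE e e' in eq
  ... | true  = yes (eqE-sound e e' eq)
  ... | false = no λ { refl → case-absurd (trans (sym eq) (eqE-refl e)) }
    where case-absurd : false ≡ true → ⊥
          case-absurd ()

  _≟tgt : (v : V) → Dec (v ≡ tgt)
  tgt     ≟tgt = yes refl
  u _     ≟tgt = no λ ()
  w _     ≟tgt = no λ ()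
  a _ _ _ ≟tgt = no λ ()
  b _ _   ≟tgt = no λ ()

  blocksAt : Fin n → List (List Ed)
  blocksAt i =
      concatMap (λ j → map (a1 i j) (allFin s)) (allFin r)
    ∷ concatMap (λ j → concatMap (λ k → map (a0 i j k) (allFin t)) (allFin s)) (allFin r)
    ∷ map (b1 i) (allFin (r * s))
    ∷ concatMap (λ j → map (b0 i j) (allFin t)) (allFin (r * s))
    ∷ map (u1 i) (allFin t)
    ∷ map (u0 i) (allFin t)
    ∷ concatMap (λ j → map (wj i j) (allFin t)) (allFin r)
    ∷ map (w0 i) (allFin t)
    ∷ []

  -- Both completeness and absence of repetitions are proved block by block on the right-hand side,
  -- which differs from `allEdges` only by a trailing `++ []` on each level.
  allEdges-blocks : allEdges ≡ concatMap (concat ∘ blocksAt) (allFin n)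
  allEdges-blocks = concatMap-cong eq (allFin n)
    where
    eq : ∀ i → _ ≡ concat (blocksAt i)
    eq i rewrite ++-identityʳ (map (w0 i) (allFin t)) = refl

  level : Ed → Fin n
  level (a1 i _ _)   = i
  level (a0 i _ _ _) = i
  level (b1 i _)     = i
  level (b0 i _ _)   = i
  level (u1 i _)     = i
  level (u0 i _)     = i
  level (wj i _ _)   = i
  level (w0 i _)     = i

  private
    in-block : ∀ e → ∃ λ es → e ∈ es × es ∈ blocksAt (level e)
    in-block (a1 i j k)   = _ , in-concatMap (λ j → map (a1 i j) (allFin s)) j (in-map _ k) , here refl
    in-block (a0 i j k l) =
      _ , in-concatMap (λ j → concatMap (λ k → map (a0 i j k) (allFin t)) (allFin s)) j
            (in-concatMap (λ k → map (a0 i j k) (allFin t)) k (in-map _ l))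
        , there (here refl)
    in-block (b1 i j)     = _ , in-map _ j , there (there (here refl))
    in-block (b0 i j l)   = _ , in-concatMap (λ j → map (b0 i j) (allFin t)) j (in-map _ l) , there (there (there (here refl)))
    in-block (u1 i l)     = _ , in-map _ l , there (there (there (there (here refl))))
    in-block (u0 i l)     = _ , in-map _ l , there (there (there (there (there (here refl)))))
    in-block (wj i j l)   =
      _ , in-concatMap (λ j → map (wj i j) (allFin t)) j (in-map _ l) , there (there (there (there (there (there (here refl))))))
    in-block (w0 i l)     = _ , in-map _ l , there (there (there (there (there (there (there (here refl)))))))

  allEdges-complete : ∀ e → e ∈ allEdges
  allEdges-complete e with es , e∈es , es∈ ← in-block e =
    subst (e ∈_) (sym allEdges-blocks)
      (in-concatMap (concat ∘ blocksAt) (level e) (∈-concat⁺′ e∈es es∈))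

-- Integer costs and acyclicity

module Ranks (n r s t : ℕ) .{{r≢0 : NonZero r}} .{{s≢0 : NonZero s}} where

  open GraphFacts n r s t {{r≢0}} {{s≢0}} public

  ρ : ℕ
  ρ = r * s

  instance
    ρ≢0 : NonZero ρ
    ρ≢0 = m*n≢0 r s

  s≤ρ : s ≤ ρ
  s≤ρ = m≤n*m s r

  -- The cost of an edge in units of ε = 1/(rs).
  cN : Ed → ℕ
  cN (a1 i j k)   = 0
  cN (a0 i j k l) = ρ * 2 ^ (2 * suc (toℕ i) + 1) + toℕ k
  cN (b1 i j)     = 0
  cN (b0 i j l)   = ρ * (2 ^ (2 * suc (toℕ i) + 1) + 1) + toℕ j
  cN (u1 i l)     = 0
  cN (u0 i l)     = ρ * 2 ^ (2 * suc (toℕ i))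
  cN (wj i j l)   = 0
  cN (w0 i l)     = ρ * 2 ^ (2 * suc (toℕ i))

  cost-cN : ∀ e → cost e ≡ cN e ÷ ρ
  cost-cN (a1 i j k)   = sym (ℚ.0/n≡0 ρ)
  cost-cN (a0 i j k l) = trans (cong (ℚ._+ timesε (toℕ k)) (÷-integer ρ (2 ^ (2 * suc (toℕ i) + 1)))) (sym (÷-+ ρ (ρ * 2 ^ (2 * suc (toℕ i) + 1)) (toℕ k)))
  cost-cN (b1 i j)     = sym (ℚ.0/n≡0 ρ)
  cost-cN (b0 i j l)   = trans (cong (ℚ._+ timesε (toℕ j)) (÷-integer ρ (2 ^ (2 * suc (toℕ i) + 1) + 1))) (sym (÷-+ ρ (ρ * (2 ^ (2 * suc (toℕ i) + 1) + 1)) (toℕ j)))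
  cost-cN (u1 i l)     = sym (ℚ.0/n≡0 ρ)
  cost-cN (u0 i l)     = ÷-integer ρ (2 ^ (2 * suc (toℕ i)))
  cost-cN (wj i j l)   = sym (ℚ.0/n≡0 ρ)
  cost-cN (w0 i l)     = ÷-integer ρ (2 ^ (2 * suc (toℕ i)))

  -- The height P of a level bounds the length of a path through it:
  -- one edge from w, s edges along a chain of a's, and ρ along the b's.
  P : ℕ
  P = 1 + (ρ + s)

  rank : V → ℕ
  rank tgt       = 0
  rank (u i)     = (n ∸ toℕ i) * P
  rank (w i)     = (n ∸ toℕ i) * P
  rank (a i j k) = (n ∸ suc (toℕ i)) * P + (ρ + (s ∸ toℕ k))
  rank (b i j)   = (n ∸ suc (toℕ i)) * P + (ρ ∸ toℕ j)

  rank-uAt : ∀ m → rank (uAt m) ≡ (n ∸ m) * P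
  rank-uAt m with m <? n
  ... | yes p = cong (λ x → (n ∸ x) * P) (Fin.toℕ-fromℕ< p)
  ... | no ¬p = cong (_* P) (sym (m≤n⇒m∸n≡0 (≮⇒≥ ¬p)))

  rank-wAt : ∀ m → rank (wAt m) ≡ (n ∸ m) * P
  rank-wAt m with m <? n
  ... | yes p = cong (λ x → (n ∸ x) * P) (Fin.toℕ-fromℕ< p)
  ... | no ¬p = cong (_* P) (sym (m≤n⇒m∸n≡0 (≮⇒≥ ¬p)))

  rank-bAt : ∀ i m → rank (bAt i m) ≡ (n ∸ suc (toℕ i)) * P + (ρ ∸ m)
  rank-bAt i m with m <? ρ
  ... | yes p = cong (λ x → (n ∸ suc (toℕ i)) * P + (ρ ∸ x)) (Fin.toℕ-fromℕ< p)
  ... | no ¬p = trans (rank-wAt (suc (toℕ i)))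
    (trans (sym (+-identityʳ _)) (cong ((n ∸ suc (toℕ i)) * P +_) (sym (m≤n⇒m∸n≡0 (≮⇒≥ ¬p)))))

  rank-aAt : ∀ i j m → rank (aAt i j m) ≡ (n ∸ suc (toℕ i)) * P + (ρ + (s ∸ m))
  rank-aAt i j m with m <? s
  ... | yes p = cong (λ x → (n ∸ suc (toℕ i)) * P + (ρ + (s ∸ x))) (Fin.toℕ-fromℕ< p)
  ... | no ¬p = trans (rank-bAt i 0) (cong ((n ∸ suc (toℕ i)) * P +_)
    (trans (sym (+-identityʳ ρ)) (cong (ρ +_) (sym (m≤n⇒m∸n≡0 (≮⇒≥ ¬p))))))

  private
    level-step : ∀ (i : Fin n) → (n ∸ toℕ i) * P ≡ (n ∸ suc (toℕ i)) * P + P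
    level-step i = trans (cong (_* P) (sym (suc-∸ (Fin.toℕ<n i)))) (+-comm P _)
      where
      suc-∸ : ∀ {m k} → k < m → suc (m ∸ suc k) ≡ m ∸ k
      suc-∸ {suc m} {k} (s≤s k≤m) = sym (+-∸-assoc 1 k≤m)

    down : ∀ {x y m k} → x ≡ m + y → y < k → x < m + k
    down {m = m} refl y<k = +-monoʳ-< m y<k

    to-level-base : ∀ {x m k} → x ≡ m → 0 < k → x < m + k
    to-level-base {m = m} refl 0<k = m<m+n m 0<k

    positive : ∀ {m} → (k : Fin m) → 0 < m ∸ toℕ k
    positive k = m<n⇒0<n∸m (Fin.toℕ<n k)

    shrink : ∀ {m} (k : Fin m) → m ∸ suc (toℕ k) < m ∸ toℕ k
    shrink k = ∸-monoʳ-< (n<1+n _) (Fin.toℕ<n k)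

  rank-decreases : ∀ e → rank (head e) < rank (tail e)
  rank-decreases (a1 i j k)   = down {m = (n ∸ suc (toℕ i)) * P} (rank-aAt i j (suc (toℕ k))) (+-monoʳ-< ρ (shrink k))
  rank-decreases (a0 i j k l) = to-level-base (rank-uAt (suc (toℕ i))) (≤-trans (positive k) (m≤n+m _ ρ))
  rank-decreases (b1 i j)     = down (rank-bAt i (suc (toℕ j))) (shrink j)
  rank-decreases (b0 i j l)   = to-level-base (rank-uAt (suc (toℕ i))) (positive j)
  rank-decreases (u1 i l) rewrite level-step i = down (rank-bAt i 0) (s≤s (m≤m+n ρ s))
  rank-decreases (u0 i l) rewrite level-step i = to-level-base (rank-uAt (suc (toℕ i))) z<s
  rank-decreases (wj i j l) rewrite level-step i = down (rank-aAt i j 0) ≤-refl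
  rank-decreases (w0 i l) rewrite level-step i = to-level-base (rank-wAt (suc (toℕ i))) z<s

  -- The fuel `numV` in the definition of `y` covers every path. The slack is in `s ≤ ρ`: a path
  -- spends at most `1 + (ρ + s)` edges on a level, and `numV` allows two vertices and `2 * ρ` more
  -- for it.
  rank≤numV : ∀ v → rank v ≤ numV
  rank≤numV v = ≤-trans (rank≤n*P v) n*P≤numV
    where
    n*P≤numV : n * P ≤ numV
    n*P≤numV = begin
      n * (1 + (ρ + s))         ≤⟨ *-monoʳ-≤ n (+-monoʳ-≤ 1 (+-monoʳ-≤ ρ s≤ρ)) ⟩
      n * (1 + (ρ + ρ))         ≡⟨ solve 2 (λ n ρ → n :* (con 1 :+ (ρ :+ ρ)) := n :+ con 2 :* (n :* ρ)) refl n ρ ⟩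
      n + 2 * (n * ρ)           ≤⟨ +-monoˡ-≤ _ (≤-trans (m≤n*m n 2) (n≤1+n _)) ⟩
      1 + 2 * n + 2 * (n * ρ)   ∎
      where open ≤-Reasoning
            open +-*-Solver
    below : ∀ (i : Fin n) {x} → x ≤ P → (n ∸ suc (toℕ i)) * P + x ≤ n * P
    below i {x} x≤P = begin
      (n ∸ suc (toℕ i)) * P + x   ≤⟨ +-monoʳ-≤ ((n ∸ suc (toℕ i)) * P) x≤P ⟩
      (n ∸ suc (toℕ i)) * P + P   ≡⟨ sym (level-step i) ⟩
      (n ∸ toℕ i) * P             ≤⟨ *-monoˡ-≤ P (m∸n≤m n (toℕ i)) ⟩
      n * P                       ∎
      where open ≤-Reasoning
    rank≤n*P : ∀ v → rank v ≤ n * P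
    rank≤n*P tgt       = z≤n
    rank≤n*P (u i)     = *-monoˡ-≤ P (m∸n≤m n (toℕ i))
    rank≤n*P (w i)     = *-monoˡ-≤ P (m∸n≤m n (toℕ i))
    rank≤n*P (a i j k) = below i (≤-trans (+-monoʳ-≤ ρ (m∸n≤m s (toℕ k))) (n≤1+n _))
    rank≤n*P (b i j)   = below i (≤-trans (m∸n≤m ρ (toℕ j)) (≤-trans (m≤m+n ρ s) (n≤1+n _)))

-- Path costs, switches and optimality of the returned tree

module Paths (n r s t : ℕ) .{{r≢0 : NonZero r}} .{{s≢0 : NonZero s}} where

  open Ranks n r s t {{r≢0}} {{s≢0}} public

  yFuelN : EdgeSet → ℕ → V → ℕ
  yFuelN B zero v = 0
  yFuelN B (suc f) v with outEdge B v
  ... | nothing = 0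
  ... | just e  = cN e + yFuelN B f (head e)

  yFuel-yFuelN : ∀ B f v → yFuel B f v ≡ yFuelN B f v ÷ ρ
  yFuel-yFuelN B zero v = sym (ℚ.0/n≡0 ρ)
  yFuel-yFuelN B (suc f) v with outEdge B v
  ... | nothing = sym (ℚ.0/n≡0 ρ)
  ... | just e  = trans (cong₂ ℚ._+_ (cost-cN e) (yFuel-yFuelN B f (head e)))
                        (sym (÷-+ ρ (cN e) (yFuelN B f (head e))))

  yN : EdgeSet → V → ℕ
  yN B = yFuelN B numV

  ImprovingN : EdgeSet → Ed → Set
  ImprovingN B e = cN e + yN B (head e) < yN B (tail e)

  private
    cost-y : ∀ B e → cost e ℚ.+ y B (head e) ≡ (cN e + yN B (head e)) ÷ ρ
    cost-y B e = trans (cong₂ ℚ._+_ (cost-cN e) (yFuel-yFuelN B numV (head e)))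
                       (sym (÷-+ ρ (cN e) (yN B (head e))))

  improving⇒N : ∀ B e → Improving B e → ImprovingN B e
  improving⇒N B e p =
    ÷-cancel-< ρ (subst₂ ℚ._<_ (cost-y B e) (yFuel-yFuelN B numV (tail e)) p)

  N⇒improving : ∀ B e → ImprovingN B e → Improving B e
  N⇒improving B e p =
    subst₂ ℚ._<_ (sym (cost-y B e)) (sym (yFuel-yFuelN B numV (tail e))) (÷-mono-< ρ p)

  findFirst-sound : ∀ p es {e} → findFirst p es ≡ just e → p e ≡ true
  findFirst-sound p (x ∷ es) eq with p x in px
  findFirst-sound p (x ∷ es) refl | true  = px
  ... | false = findFirst-sound p es eq

  findFirst-complete : ∀ p es {e} → e ∈ es → p e ≡ true → findFirst p es ≢ nothing
  findFirst-complete p (x ∷ es) (here refl) pe eq rewrite pe with () ← eq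
  findFirst-complete p (x ∷ es) (there e∈) pe eq with p x
  ... | true with () ← eq
  ... | false = findFirst-complete p es e∈ pe eq

  outEdge-sound : ∀ B v {e} → outEdge B v ≡ just e → (B e ≡ true) × (tail e ≡ v)
  outEdge-sound B v {e} eq with ∧-true {B e} (findFirst-sound (λ e → B e ∧ eqV (tail e) v) allEdges eq)
  ... | Be , te = Be , eqV-sound (tail e) v te

  tail≢tgt : ∀ e → tail e ≢ tgt
  tail≢tgt (a1 i j k) ()

  out : ∀ {B} → IsTree B → ∀ v → v ≡ tgt ⊎ ∃ λ e → (B e ≡ true) × (tail e ≡ v)
  out tree v with v ≟tgt
  ... | yes v≡tgt = inj₁ v≡tgt
  ... | no v≢tgt with e , Be , te , _ ← tree v v≢tgt = inj₂ (e , Be , te)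

  tree-unique : ∀ {B} → IsTree B → ∀ {e e'} → B e ≡ true → B e' ≡ true → tail e ≡ tail e' → e ≡ e'
  tree-unique tree {e} {e'} Be Be' eq with f , _ , _ , uniq ← tree (tail e) (tail≢tgt e) =
    trans (uniq e Be refl) (sym (uniq e' Be' (sym eq)))

  outEdge-tree : ∀ {B} → IsTree B → ∀ {e} → B e ≡ true → outEdge B (tail e) ≡ just e
  outEdge-tree {B} tree {e} Be with outEdge B (tail e) in eq
  ... | nothing = ⊥-elim (findFirst-complete (λ e' → B e' ∧ eqV (tail e') (tail e)) allEdges
                    (allEdges-complete e) (∧-intro Be (eqV-refl (tail e))) eq)
  ... | just e' with Be' , te' ← outEdge-sound B (tail e) eq = cong just (tree-unique tree Be' Be te')

  -- Rank drops along every edge, so a path from v ends within `rank v` steps, before either supply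
  -- of fuel runs out.
  fuel-irrelevant : ∀ B f f' v → rank v ≤ f → rank v ≤ f' → yFuelN B f v ≡ yFuelN B f' v
  fuel-irrelevant B zero zero v p q = refl
  fuel-irrelevant B zero (suc f') v p q with outEdge B v in eq
  ... | nothing = refl
  ... | just e with _ , refl ← outEdge-sound B v eq = ⊥-elim (n≮0 (<-≤-trans (rank-decreases e) p))
  fuel-irrelevant B (suc f) zero v p q with outEdge B v in eq
  ... | nothing = refl
  ... | just e with _ , refl ← outEdge-sound B v eq = ⊥-elim (n≮0 (<-≤-trans (rank-decreases e) q))
  fuel-irrelevant B (suc f) (suc f') v p q with outEdge B v in eq
  ... | nothing = refl
  ... | just e with _ , refl ← outEdge-sound B v eq =
    cong (cN e +_) (fuel-irrelevant B f f' (head e)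
      (s≤s⁻¹ (<-≤-trans (rank-decreases e) p)) (s≤s⁻¹ (<-≤-trans (rank-decreases e) q)))

  yN-tail : ∀ {B} → IsTree B → ∀ {e} → B e ≡ true → yN B (tail e) ≡ cN e + yN B (head e)
  yN-tail {B} tree {e} Be = trans (fuel-irrelevant B numV (suc numV) (tail e) (rank≤numV (tail e)) (m≤n⇒m≤1+n (rank≤numV (tail e)))) step
    where
    step : yFuelN B (suc numV) (tail e) ≡ cN e + yN B (head e)
    step rewrite outEdge-tree tree Be = refl

  yN-tgt : ∀ B → yN B tgt ≡ 0
  yN-tgt B = fuel-irrelevant B numV 0 tgt z≤n z≤n

  tree-ind : ∀ {B} → IsTree B → (Q : V → Set) → Q tgt →
             (∀ e → B e ≡ true → Q (head e) → Q (tail e)) → ∀ v → Q v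
  tree-ind {B} tree Q base step v = go (rank v) v ≤-refl
    where
    go : ∀ k v → rank v ≤ k → Q v
    go k v rk with out tree v
    ... | inj₁ refl = base
    go zero v rk | inj₂ (e , Be , refl) = ⊥-elim (n≮0 (<-≤-trans (rank-decreases e) rk))
    go (suc k) v rk | inj₂ (e , Be , refl) = step e Be (go k (head e) (s≤s⁻¹ (<-≤-trans (rank-decreases e) rk)))

  -- Summing the inequality for φ along the path of v telescopes. Only edges of tail rank at most R
  -- are tested, so that an edge higher up, such as the one just inserted, may violate it.
  yN-lower : ∀ {C} → IsTree C → (R : ℕ) (φ : V → ℕ) → φ tgt ≡ 0 →
             (∀ e → C e ≡ true → rank (tail e) ≤ R → φ (tail e) ≤ cN e + φ (head e)) →
             ∀ v → rank v ≤ R → φ v ≤ yN C v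
  yN-lower {C} tree R φ φ0 sub = tree-ind tree (λ v → rank v ≤ R → φ v ≤ yN C v)
    (λ _ → subst (_≤ yN C tgt) (sym φ0) z≤n)
    λ e Ce ih rk → ≤-trans (sub e Ce rk)
      (≤-trans (+-monoʳ-≤ (cN e) (ih (≤-trans (<⇒≤ (rank-decreases e)) rk))) (≤-reflexive (sym (yN-tail tree Ce))))

  yN-upper : ∀ {C} → IsTree C → (φ : V → ℕ) →
             (∀ e → C e ≡ true → cN e + φ (head e) ≤ φ (tail e)) → ∀ v → yN C v ≤ φ v
  yN-upper {C} tree φ sup = tree-ind tree (λ v → yN C v ≤ φ v)
    (subst (_≤ φ tgt) (sym (yN-tgt C)) z≤n)
    λ e Ce ih → ≤-trans (≤-reflexive (yN-tail tree Ce)) (≤-trans (+-monoʳ-≤ (cN e) ih) (sup e Ce))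

  _⊑_ : EdgeSet → EdgeSet → Set
  B ⊑ F = ∀ e → B e ≡ true → F e ≡ true

  ⊑-trans : ∀ {A B C} → A ⊑ B → B ⊑ C → A ⊑ C
  ⊑-trans p q e Ae = q e (p e Ae)

  switch-cases : ∀ B e f → switch B e f ≡ true → f ≡ e ⊎ (B f ≡ true × tail f ≢ tail e)
  switch-cases B e f p with eqV (tail f) (tail e) in eq
  ... | true = inj₁ (eqE-sound f e p)
  ... | false = inj₂ (p , λ te → t≢f (trans (sym (trans (cong (eqV (tail f)) (sym te)) (eqV-refl (tail f)))) eq))
    where t≢f : true ≡ false → ⊥
          t≢f ()

  switch-new : ∀ B e → switch B e e ≡ true
  switch-new B e rewrite eqV-refl (tail e) = eqE-refl e

  switch-old : ∀ B e f → B f ≡ true → tail f ≢ tail e → switch B e f ≡ true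
  switch-old B e f Bf ne with eqV (tail f) (tail e) in eq
  ... | true  = ⊥-elim (ne (eqV-sound _ _ eq))
  ... | false = Bf

  switch-tree : ∀ {B} → IsTree B → ∀ e → IsTree (switch B e)
  switch-tree {B} tree e v v≢tgt with eqV v (tail e) in eq
  ... | true with refl ← eqV-sound v (tail e) eq = e , switch-new B e , refl , uniq
    where
    uniq : ∀ f → switch B e f ≡ true → tail f ≡ tail e → f ≡ e
    uniq f p te with switch-cases B e f p
    ... | inj₁ f≡e = f≡e
    ... | inj₂ (_ , ne) = ⊥-elim (ne te)
  ... | false with g , Bg , refl , uniq ← tree v v≢tgt = g , switch-old B e g Bg ne , refl , uniq′
    where
    t≢f : true ≡ false → ⊥
    t≢f ()
    ne : tail g ≢ tail e
    ne te = t≢f (trans (sym (trans (cong (eqV (tail g)) (sym te)) (eqV-refl (tail g)))) eq)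
    uniq′ : ∀ f → switch B e f ≡ true → tail f ≡ tail g → f ≡ g
    uniq′ f p tf with switch-cases B e f p
    ... | inj₁ refl = ⊥-elim (ne (sym tf))
    ... | inj₂ (Bf , _) = uniq f Bf tf

  switch-⊑ : ∀ {B F} → B ⊑ F → ∀ e → F e ≡ true → switch B e ⊑ F
  switch-⊑ {B} B⊑F e Fe f p with switch-cases B e f p
  ... | inj₁ refl = Fe
  ... | inj₂ (Bf , _) = B⊑F f Bf

  -- The old path costs satisfy the inequality of `yN-upper` on the new tree: with equality on the
  -- kept edges, strictly on `e`.
  switch-≤ : ∀ {B} → IsTree B → ∀ {e} → ImprovingN B e → ∀ v → yN (switch B e) v ≤ yN B v
  switch-≤ {B} tree {e} imp = yN-upper (switch-tree tree e) (yN B) sup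
    where
    sup : ∀ f → switch B e f ≡ true → cN f + yN B (head f) ≤ yN B (tail f)
    sup f p with switch-cases B e f p
    ... | inj₁ refl = <⇒≤ imp
    ... | inj₂ (Bf , _) = ≤-reflexive (sym (yN-tail tree Bf))

  switch-< : ∀ {B} → IsTree B → ∀ {e} → ImprovingN B e → yN (switch B e) (tail e) < yN B (tail e)
  switch-< {B} tree {e} imp = ≤-<-trans
    (≤-trans (≤-reflexive (yN-tail (switch-tree tree e) (switch-new B e))) (+-monoʳ-≤ (cN e) (switch-≤ tree imp (head e)))) imp

  remove-⊑ : ∀ F e → remove F e ⊑ F
  remove-⊑ F e f p = proj₁ (∧-true p)

  remove-≢ : ∀ F e f → remove F e f ≡ true → f ≢ e
  remove-≢ F e f p refl with F e | eqE e e | eqE-refl e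
  remove-≢ F e .e () refl | true  | .true | refl
  remove-≢ F e .e () refl | false | .true | refl

  remove-keep : ∀ F e f → F f ≡ true → f ≢ e → remove F e f ≡ true
  remove-keep F e f Ff ne with eqE f e in eq
  ... | true  = ⊥-elim (ne (eqE-sound f e eq))
  ... | false = ∧-intro Ff refl

  ⊑-remove : ∀ {B F} e → B ⊑ F → B e ≡ false → B ⊑ remove F e
  ⊑-remove {B} {F} e B⊑F Be f Bf = remove-keep F e f (B⊑F f Bf) λ { refl → f≢t (trans (sym Be) Bf) }
    where f≢t : false ≡ true → ⊥
          f≢t ()

  firstOut-sound : ∀ ord F B {e} → firstOut ord F B ≡ just e → (F e ≡ true) × (B e ≡ false)
  firstOut-sound ord F B {e} eq with ∧-true {F e} (findFirst-sound (λ e → F e ∧ not (B e)) ord eq)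
  ... | Fe , nBe with B e
  ...   | false = Fe , refl

  -- `minimal` is Bellman's condition; for a tree inside F it says that path costs are shortest
  -- distances in F.
  record Opt (F T : EdgeSet) : Set where
    field
      tree    : IsTree T
      inside  : T ⊑ F
      minimal : ∀ e → F e ≡ true → yN T (tail e) ≤ cN e + yN T (head e)

  -- After `skip`, the failed improvement is precisely the inequality that optimality for
  -- `remove F e` lacks; after `take`, the second call is optimal for F already. The monotonicity in
  -- the second component is what later keeps a `Lock` valid from call to call.
  RF-opt : ∀ {ord F B B' k} → RF ord F B B' k → IsTree B → B ⊑ F → Opt F B' × (∀ v → yN B' v ≤ yN B v)
  RF-opt (done F≡B) tree B⊑F = record
    { tree = tree ; inside = B⊑F
    ; minimal = λ e Fe → ≤-reflexive (yN-tail tree (trans (sym (F≡B e)) Fe)) } , λ _ → ≤-refl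
  RF-opt {ord} {F} {B} {B'} (skip {e = e} fo d nimp) tree B⊑F
    with RF-opt d tree (⊑-remove e B⊑F (proj₂ (firstOut-sound ord F B fo)))
  ... | o , le = record
    { tree = o.tree ; inside = ⊑-trans o.inside (remove-⊑ F e) ; minimal = minimal } , le
    where
    module o = Opt o
    minimal : ∀ f → F f ≡ true → yN B' (tail f) ≤ cN f + yN B' (head f)
    minimal f Ff with f ≟E e
    ... | yes refl = ≮⇒≥ λ lt → nimp (N⇒improving B' e lt)
    ... | no f≢e = o.minimal f (remove-keep F e f Ff f≢e)
  RF-opt {ord} {F} {B} (take {B' = B'} {e = e} fo d imp d') tree B⊑F
    with RF-opt d tree (⊑-remove e B⊑F (proj₂ (firstOut-sound ord F B fo)))
  ... | o , le with RF-opt d' (switch-tree (Opt.tree o) e)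
                    (switch-⊑ (⊑-trans (Opt.inside o) (remove-⊑ F e)) e (proj₁ (firstOut-sound ord F B fo)))
  ... | o' , le' = o' , λ v → ≤-trans (le' v) (≤-trans (switch-≤ (Opt.tree o) (improving⇒N B' e imp) v) (le v))

-- Termination of Random-Facet

sum-map-≤ : ∀ {A : Set} {f g : A → ℕ} xs → (∀ x → f x ≤ g x) → sum (map f xs) ≤ sum (map g xs)
sum-map-≤ [] le = z≤n
sum-map-≤ (x ∷ xs) le = +-mono-≤ (le x) (sum-map-≤ xs le)

sum-map-< : ∀ {A : Set} {f g : A → ℕ} {xs x} → (∀ x → f x ≤ g x) → x ∈ xs → f x < g x →
            sum (map f xs) < sum (map g xs)
sum-map-< {xs = _ ∷ xs} le (here refl) lt = +-mono-<-≤ lt (sum-map-≤ xs le)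
sum-map-< le (there x∈) lt = +-mono-≤-< (le _) (sum-map-< le x∈ lt)

module Termination (n r s t : ℕ) .{{r≢0 : NonZero r}} .{{s≢0 : NonZero s}} where

  open Paths n r s t {{r≢0}} {{s≢0}} public

  private
    total : EdgeSet → ℕ
    total B = sum (map (λ e → yN B (tail e)) allEdges)

    size : EdgeSet → ℕ
    size F = sum (map (λ e → if F e then 1 else 0) allEdges)

    total-switch : ∀ {B} → IsTree B → ∀ {e} → ImprovingN B e → total (switch B e) < total B
    total-switch tree {e} imp =
      sum-map-< (λ f → switch-≤ tree imp (tail f)) (allEdges-complete e) (switch-< tree imp)

    size-remove : ∀ F e → F e ≡ true → size (remove F e) < size F
    size-remove F e Fe = sum-map-< le (allEdges-complete e) lt
      where
      le : ∀ f → (if remove F e f then 1 else 0) ≤ (if F f then 1 else 0)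
      le f with F f
      ... | false = z≤n
      ... | true with not (eqE f e)
      ...   | true  = ≤-refl
      ...   | false = z≤n
      lt : (if remove F e e then 1 else 0) < (if F e then 1 else 0)
      lt rewrite Fe | eqE-refl e = ≤-refl

    firstOut-none : ∀ ord → (∀ e → e ∈ ord) → ∀ F B → B ⊑ F → firstOut ord F B ≡ nothing → ∀ e → F e ≡ B e
    firstOut-none ord all∈ F B B⊑F eq e with F e in Fe | B e in Be
    ... | true  | true  = refl
    ... | false | false = refl
    ... | false | true  = trans (sym Fe) (B⊑F e Be)
    ... | true  | false = ⊥-elim (findFirst-complete (λ e → F e ∧ not (B e)) ord (all∈ e)
                            (∧-true′ Fe Be) eq)
      where
      ∧-true′ : ∀ {x y} → x ≡ true → y ≡ false → x ∧ not y ≡ true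
      ∧-true′ refl refl = refl

  RF-exists : ∀ ord → (∀ e → e ∈ ord) → ∀ F B → IsTree B → B ⊑ F → ∃₂ λ B' k → RF ord F B B' k
  RF-exists ord all∈ F B tree B⊑F = go (total B) (size F) F B tree B⊑F ≤-refl ≤-refl
    where
    -- Lexicographic recursion: a switch lowers the total path cost, otherwise F shrinks.
    go : ∀ p q F B → IsTree B → B ⊑ F → total B ≤ p → size F ≤ q → ∃₂ λ B' k → RF ord F B B' k
    go p q F B tree B⊑F tp sq with firstOut ord F B in fo
    ... | nothing = B , 0 , done (firstOut-none ord all∈ F B B⊑F fo)
    go p zero F B tree B⊑F tp sq | just e =
      ⊥-elim (n≮0 (<-≤-trans (size-remove F e (proj₁ (firstOut-sound ord F B fo))) sq))
    go p (suc q) F B tree B⊑F tp sq | just e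
      with Fe , Be ← firstOut-sound ord F B fo
      with B' , k , d ← go p q (remove F e) B tree (⊑-remove e B⊑F Be) tp
                          (s≤s⁻¹ (<-≤-trans (size-remove F e Fe) sq))
      with o , le ← RF-opt d tree (⊑-remove e B⊑F Be)
      with cN e + yN B' (head e) <? yN B' (tail e)
    ... | no ¬imp = B' , k , skip fo d λ imp → ¬imp (improving⇒N B' e imp)
    ... | yes imp = again p (<-≤-trans (total-switch (Opt.tree o) imp)
                               (≤-trans (sum-map-≤ allEdges (λ f → le (tail f))) tp))
      where
      again : ∀ p → total (switch B' e) < p → ∃₂ λ B'' k → RF ord F B B'' k
      again (suc p) lt with B'' , k' , d' ← go p (size F) F (switch B' e) (switch-tree (Opt.tree o) e)
                                   (switch-⊑ (⊑-trans (Opt.inside o) (remove-⊑ F e)) e Fe) (s≤s⁻¹ lt) ≤-refl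
        = B'' , k + suc k' , take fo d (N⇒improving B' e imp) d'

-- Shortest distances within one level

from-Fin : ∀ {N} (Q : ℕ → Set) → (∀ (j : Fin N) → Q (toℕ j)) → ∀ m → m < N → Q m
from-Fin Q h m m<N = subst Q (Fin.toℕ-fromℕ< m<N) (h (fromℕ< m<N))

ladder-ind : (N : ℕ) (Q : ℕ → Set) → Q N → (∀ m → m < N → Q (suc m) → Q m) → ∀ m → m ≤ N → Q m
ladder-ind zero Q base step zero z≤n = base
ladder-ind (suc N) Q base step m m≤ with m ≟ suc N
... | yes refl = base
... | no m≢ = ladder-ind N Q (step N ≤-refl base) (λ k k<N → step k (m≤n⇒m≤1+n k<N)) m (s≤s⁻¹ (≤∧≢⇒< m≤ m≢))

-- Made for a row of a's or b's: going backwards, the distance f either is inherited from the next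
-- vertex or is that of the zero-edge taken here, which g bounds.
ladder-lower : ∀ {N} (f g : ℕ → ℕ) → (∀ m → g m ≤ g (suc m)) →
               (∀ m → m < N → f m ≡ f (suc m) ⊎ g m ≤ f m) → g N ≤ f N → ∀ m → m ≤ N → g m ≤ f m
ladder-lower {N} f g mono step base = ladder-ind N (λ m → g m ≤ f m) base down
  where
  down : ∀ m → m < N → g (suc m) ≤ f (suc m) → g m ≤ f m
  down m m<N ih with step m m<N
  ... | inj₁ eq = ≤-trans (mono m) (≤-trans ih (≤-reflexive (sym eq)))
  ... | inj₂ le = le

module Levels (n r s t : ℕ) .{{r≢0 : NonZero r}} .{{s≢0 : NonZero s}} where

  open Termination n r s t {{r≢0}} {{s≢0}} public

  uAt-toℕ : ∀ i → uAt (toℕ i) ≡ u i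
  uAt-toℕ i with toℕ i <? n
  ... | yes p = cong u (Fin.fromℕ<-toℕ i p)
  ... | no ¬p = ⊥-elim (¬p (Fin.toℕ<n i))

  wAt-toℕ : ∀ i → wAt (toℕ i) ≡ w i
  wAt-toℕ i with toℕ i <? n
  ... | yes p = cong w (Fin.fromℕ<-toℕ i p)
  ... | no ¬p = ⊥-elim (¬p (Fin.toℕ<n i))

  uAt-n : uAt n ≡ tgt
  uAt-n with n <? n
  ... | yes p = ⊥-elim (<-irrefl refl p)
  ... | no _ = refl

  wAt-n : wAt n ≡ tgt
  wAt-n with n <? n
  ... | yes p = ⊥-elim (<-irrefl refl p)
  ... | no _ = refl

  bAt-toℕ : ∀ i j → bAt i (toℕ j) ≡ b i j
  bAt-toℕ i j with toℕ j <? ρ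
  ... | yes p = cong (b i) (Fin.fromℕ<-toℕ j p)
  ... | no ¬p = ⊥-elim (¬p (Fin.toℕ<n j))

  bAt-ρ : ∀ i → bAt i ρ ≡ wAt (suc (toℕ i))
  bAt-ρ i with ρ <? ρ
  ... | yes p = ⊥-elim (<-irrefl refl p)
  ... | no _ = refl

  aAt-toℕ : ∀ i j k → aAt i j (toℕ k) ≡ a i j k
  aAt-toℕ i j k with toℕ k <? s
  ... | yes p = cong (a i j) (Fin.fromℕ<-toℕ k p)
  ... | no ¬p = ⊥-elim (¬p (Fin.toℕ<n k))

  aAt-s : ∀ i j → aAt i j s ≡ bAt i 0
  aAt-s i j with s <? s
  ... | yes p = ⊥-elim (<-irrefl refl p)
  ... | no _ = refl

  -- The cost of `u0` and `w0` at the 0-based level m, in units of ε. It takes any natural number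
  -- because gaps are also stated one level above.
  q : ℕ → ℕ
  q m = ρ * 2 ^ (2 * suc m)

  private
    ρ2^ : ∀ x → ρ * 2 ^ (x + 1) ≡ 2 * (ρ * 2 ^ x)
    ρ2^ x rewrite +-comm x 1 = solve 2 (λ ρ p → ρ :* (con 2 :* p) := con 2 :* (ρ :* p)) refl ρ (2 ^ x)
      where open +-*-Solver

  q-suc : ∀ m → q (suc m) ≡ 4 * q m
  q-suc m rewrite +-suc m (suc (m + 0)) =
    solve 2 (λ ρ p → ρ :* (con 2 :* (con 2 :* p)) := con 4 :* (ρ :* p)) refl ρ (2 ^ (2 * suc m))
    where open +-*-Solver

  ρ≤q : ∀ m → ρ ≤ q m
  ρ≤q m = m≤m*n ρ (2 ^ (2 * suc m)) {{m^n≢0 2 (2 * suc m)}}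

  0<ρ : 0 < ρ
  0<ρ = n≢0⇒n>0 (≢-nonZero⁻¹ ρ)

  cN-a0 : ∀ i j k l → cN (a0 i j k l) ≡ 2 * q (toℕ i) + toℕ k
  cN-a0 i j k l = cong (_+ toℕ k) (ρ2^ (2 * suc (toℕ i)))

  cN-b0 : ∀ i j l → cN (b0 i j l) ≡ 2 * q (toℕ i) + ρ + toℕ j
  cN-b0 i j l = cong (_+ toℕ j) (trans (*-distribˡ-+ ρ (2 ^ (2 * suc (toℕ i) + 1)) 1)
    (cong₂ _+_ (ρ2^ (2 * suc (toℕ i))) (*-identityʳ ρ)))

  AllB : EdgeSet → Fin n → Set
  AllB F i = ∀ j → F (b1 i j) ≡ true

  Chain : EdgeSet → Fin n → Fin r → Set
  Chain F i j = ∀ k → F (a1 i j k) ≡ true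

  -- With one copy of each bundle present, distances depend only on which `a1` and `b1` edges are
  -- there. The number of copies matters only for the probability that a bundle survives.
  record Rich (F : EdgeSet) : Set where
    field
      has-u0 : ∀ i → ∃ λ l → F (u0 i l) ≡ true
      has-w0 : ∀ i → ∃ λ l → F (w0 i l) ≡ true
      has-a0 : ∀ i j k → ∃ λ l → F (a0 i j k l) ≡ true
      has-b0 : ∀ i j → ∃ λ l → F (b0 i j l) ≡ true
      has-u1 : ∀ i → ∃ λ l → F (u1 i l) ≡ true
      has-wj : ∀ i j → ∃ λ l → F (wj i j l) ≡ true

  module At {F T : EdgeSet} (rich : Rich F) (opt : Opt F T) (i : Fin n) where
    open Rich rich
    open Opt opt

    Y : V → ℕ
    Y = yN T

    U W Q : ℕ
    U = Y (uAt (suc (toℕ i)))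
    W = Y (wAt (suc (toℕ i)))
    Q = q (toℕ i)

    out-b : ∀ j → (T (b1 i j) ≡ true × Y (bAt i (toℕ j)) ≡ Y (bAt i (suc (toℕ j))))
                ⊎ Y (bAt i (toℕ j)) ≡ 2 * Q + ρ + toℕ j + U
    out-b j rewrite bAt-toℕ i j with out tree (b i j)
    ... | inj₂ (b1 _ _ , Te , refl)   = inj₁ (Te , yN-tail tree Te)
    ... | inj₂ (b0 _ _ l , Te , refl) = inj₂ (trans (yN-tail tree Te) (cong (_+ U) (cN-b0 i j l)))

    out-a : ∀ j k → (T (a1 i j k) ≡ true × Y (aAt i j (toℕ k)) ≡ Y (aAt i j (suc (toℕ k))))
                  ⊎ Y (aAt i j (toℕ k)) ≡ 2 * Q + toℕ k + U
    out-a j k rewrite aAt-toℕ i j k with out tree (a i j k)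
    ... | inj₂ (a1 _ _ _ , Te , refl)   = inj₁ (Te , yN-tail tree Te)
    ... | inj₂ (a0 _ _ _ l , Te , refl) = inj₂ (trans (yN-tail tree Te) (cong (_+ U) (cN-a0 i j k l)))

    out-u : Y (u i) ≡ Y (bAt i 0) ⊎ Y (u i) ≡ Q + U
    out-u with out tree (u i)
    ... | inj₂ (u1 _ l , Te , refl) = inj₁ (yN-tail tree Te)
    ... | inj₂ (u0 _ l , Te , refl) = inj₂ (yN-tail tree Te)

    out-w : (∃ λ j → Y (w i) ≡ Y (aAt i j 0)) ⊎ Y (w i) ≡ Q + W
    out-w with out tree (w i)
    ... | inj₂ (wj _ j l , Te , refl) = inj₁ (j , yN-tail tree Te)
    ... | inj₂ (w0 _ l , Te , refl)   = inj₂ (yN-tail tree Te)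

    u≤ : Y (u i) ≤ Q + U
    u≤ = minimal _ (proj₂ (has-u0 i))

    u≤b : Y (u i) ≤ Y (bAt i 0)
    u≤b = minimal _ (proj₂ (has-u1 i))

    w≤ : Y (w i) ≤ Q + W
    w≤ = minimal _ (proj₂ (has-w0 i))

    w≤a : ∀ j → Y (w i) ≤ Y (aAt i j 0)
    w≤a j = minimal _ (proj₂ (has-wj i j))

    b≤ : ∀ j → Y (bAt i (toℕ j)) ≤ 2 * Q + ρ + toℕ j + U
    b≤ j rewrite bAt-toℕ i j with l , Fe ← has-b0 i j =
      ≤-trans (minimal _ Fe) (≤-reflexive (cong (_+ U) (cN-b0 i j l)))

    a≤ : ∀ j k → Y (aAt i j (toℕ k)) ≤ 2 * Q + toℕ k + U
    a≤ j k rewrite aAt-toℕ i j k with l , Fe ← has-a0 i j k =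
      ≤-trans (minimal _ Fe) (≤-reflexive (cong (_+ U) (cN-a0 i j k l)))

    b-step : ∀ {g : ℕ → ℕ} → (∀ m → g m ≤ 2 * Q + ρ + m + U) →
             ∀ m → m < ρ → Y (bAt i m) ≡ Y (bAt i (suc m)) ⊎ g m ≤ Y (bAt i m)
    b-step {g} g≤ = from-Fin _ λ j → classify j (out-b j)
      where
      classify : ∀ j → _ → Y (bAt i (toℕ j)) ≡ Y (bAt i (suc (toℕ j))) ⊎ g (toℕ j) ≤ Y (bAt i (toℕ j))
      classify j (inj₁ (_ , eq)) = inj₁ eq
      classify j (inj₂ eq) = inj₂ (≤-trans (g≤ (toℕ j)) (≤-reflexive (sym eq)))

    a-step : ∀ {g : ℕ → ℕ} → (∀ m → g m ≤ 2 * Q + m + U) →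
             ∀ j m → m < s → Y (aAt i j m) ≡ Y (aAt i j (suc m)) ⊎ g m ≤ Y (aAt i j m)
    a-step {g} g≤ j = from-Fin _ λ k → classify k (out-a j k)
      where
      classify : ∀ k → _ → Y (aAt i j (toℕ k)) ≡ Y (aAt i j (suc (toℕ k))) ⊎ g (toℕ k) ≤ Y (aAt i j (toℕ k))
      classify k (inj₁ (_ , eq)) = inj₁ eq
      classify k (inj₂ eq) = inj₂ (≤-trans (g≤ (toℕ k)) (≤-reflexive (sym eq)))

    b-lower : ∀ {Z} → Z ≤ U → Z ≤ W → ∀ m → m ≤ ρ → Z ≤ Y (bAt i m)
    b-lower {Z} Z≤U Z≤W = ladder-lower (λ m → Y (bAt i m)) (λ _ → Z) (λ _ → ≤-refl)
      (b-step (λ m → ≤-trans Z≤U (m≤n+m U _))) (subst (λ v → Z ≤ Y v) (sym (bAt-ρ i)) Z≤W)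

    a-lower : ∀ {Z} → Z ≤ 2 * Q + U → Z ≤ Y (bAt i 0) → ∀ j m → m ≤ s → Z ≤ Y (aAt i j m)
    a-lower {Z} Z≤U Z≤b j = ladder-lower (λ m → Y (aAt i j m)) (λ _ → Z) (λ _ → ≤-refl)
      (a-step (λ m → ≤-trans Z≤U (+-monoˡ-≤ U (m≤m+n (2 * Q) m))) j) (subst (λ v → Z ≤ Y v) (sym (aAt-s i j)) Z≤b)

    b-incomplete : ∀ j → T (b1 i j) ≢ true → ∀ m → m ≤ toℕ j → 2 * Q + ρ + U ≤ Y (bAt i m)
    b-incomplete j ¬T = ladder-lower {toℕ j} (λ m → Y (bAt i m)) (λ _ → 2 * Q + ρ + U) (λ _ → ≤-refl)
      (λ m m<j → b-step (λ m → +-monoˡ-≤ U (m≤m+n (2 * Q + ρ) m)) m (<-trans m<j (Fin.toℕ<n j))) base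
      where
      base : 2 * Q + ρ + U ≤ Y (bAt i (toℕ j))
      base with out-b j
      ... | inj₁ (Te , _) = ⊥-elim (¬T Te)
      ... | inj₂ eq = ≤-trans (+-monoˡ-≤ U (m≤m+n (2 * Q + ρ) (toℕ j))) (≤-reflexive (sym eq))

    a-incomplete : ∀ j k → T (a1 i j k) ≢ true → ∀ m → m ≤ toℕ k → 2 * Q + U ≤ Y (aAt i j m)
    a-incomplete j k ¬T = ladder-lower {toℕ k} (λ m → Y (aAt i j m)) (λ _ → 2 * Q + U) (λ _ → ≤-refl)
      (λ m m<k → a-step (λ m → +-monoˡ-≤ U (m≤m+n (2 * Q) m)) j m (<-trans m<k (Fin.toℕ<n k))) base
      where
      base : 2 * Q + U ≤ Y (aAt i j (toℕ k))
      base with out-a j k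
      ... | inj₁ (Te , _) = ⊥-elim (¬T Te)
      ... | inj₂ eq = ≤-trans (+-monoˡ-≤ U (m≤m+n (2 * Q) (toℕ k))) (≤-reflexive (sym eq))

    b-complete : AllB F i → ∀ m → m ≤ ρ → Y (bAt i m) ≤ W
    b-complete allB = ladder-ind ρ (λ m → Y (bAt i m) ≤ W) (≤-reflexive (cong Y (bAt-ρ i)))
      λ m m<ρ ih → ≤-trans (from-Fin (λ m → Y (bAt i m) ≤ Y (bAt i (suc m)))
        (λ j → ≤-trans (≤-reflexive (cong Y (bAt-toℕ i j))) (minimal (b1 i j) (allB j))) m m<ρ) ih

    a-complete : ∀ {j} → Chain F i j → ∀ m → m ≤ s → Y (aAt i j m) ≤ Y (bAt i 0)
    a-complete {j} ch = ladder-ind s (λ m → Y (aAt i j m) ≤ Y (bAt i 0)) (≤-reflexive (cong Y (aAt-s i j)))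
      λ m m<s ih → ≤-trans (from-Fin (λ m → Y (aAt i j m) ≤ Y (aAt i j (suc m)))
        (λ k → ≤-trans (≤-reflexive (cong Y (aAt-toℕ i j k))) (minimal (a1 i j k) (ch k))) m m<s) ih

    private
      suc-+ : ∀ x m y → x + m + y ≤ x + suc m + y
      suc-+ x m y = +-monoˡ-≤ y (+-monoʳ-≤ x (n≤1+n m))

      too-big : ∀ {x y m z} → z ≤ y → 0 < x → ¬ (x + m + y ≤ z)
      too-big {x} {y} {m} z≤y 0<x le = <-irrefl refl (<-≤-trans (m<n+m y (<-≤-trans 0<x (m≤m+n x m))) (≤-trans le z≤y))

      0<2Q : 0 < 2 * Q
      0<2Q = <-≤-trans (<-≤-trans 0<ρ (ρ≤q (toℕ i))) (m≤n*m Q 2)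

      no-climb : ∀ {x m y z z'} → z ≡ z' → x + suc m + y ≤ z' → ¬ (z ≤ x + m + y)
      no-climb {x} {m} {y} refl lo hi =
        <-irrefl refl (<-≤-trans (+-monoˡ-< y (+-monoʳ-< x (n<1+n m))) (≤-trans lo hi))

    -- Walking to the end of the row costs at most W, whereas a zero-edge costs at least `2 * Q` on
    -- top of `U ≥ W`.
    b-set : W ≤ U → AllB F i → ∀ j → T (b1 i j) ≡ true
    b-set W≤U allB j with out-b j
    ... | inj₁ (Te , _) = Te
    ... | inj₂ eq = ⊥-elim (too-big W≤U (<-≤-trans 0<2Q (m≤m+n (2 * Q) ρ))
      (≤-trans (≤-reflexive (sym eq)) (b-complete allB (toℕ j) (<⇒≤ (Fin.toℕ<n j)))))

    a-set : W ≤ U → AllB F i → ∀ {j} → Chain F i j → ∀ k → T (a1 i j k) ≡ true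
    a-set W≤U allB {j} ch k with out-a j k
    ... | inj₁ (Te , _) = Te
    ... | inj₂ eq = ⊥-elim (too-big W≤U 0<2Q
      (≤-trans (≤-reflexive (sym eq)) (≤-trans (a-complete ch (toℕ k) (<⇒≤ (Fin.toℕ<n k))) (b-complete allB 0 z≤n))))

    -- Here the small terms of the costs act: a zero-edge gets one unit dearer with each step along
    -- the row, so leaving at once beats leaving later. Walking on to the b's is no better, since
    -- they cost at least `2 * Q + ρ + U` and `s ≤ ρ`.
    a-unset : 2 * Q + ρ + U ≤ Y (bAt i 0) → ∀ j k → T (a1 i j k) ≢ true
    a-unset lo j k Te = no-climb {x = 2 * Q} {toℕ k} {U} eq (ladder-lower (λ m → Y (aAt i j m)) (λ m → 2 * Q + m + U) (λ m → suc-+ (2 * Q) m U)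
        (a-step (λ m → ≤-refl) j) base (suc (toℕ k)) (Fin.toℕ<n k)) (a≤ j k)
      where
      base : 2 * Q + s + U ≤ Y (aAt i j s)
      base = ≤-trans (+-monoˡ-≤ U (+-monoʳ-≤ (2 * Q) s≤ρ)) (subst (λ v → 2 * Q + ρ + U ≤ Y v) (sym (aAt-s i j)) lo)
      eq : Y (aAt i j (toℕ k)) ≡ Y (aAt i j (suc (toℕ k)))
      eq = trans (cong Y (aAt-toℕ i j k)) (yN-tail tree Te)

    b-gap : 2 * Q + ρ + ρ + U ≤ W → ∀ m → m ≤ ρ → 2 * Q + ρ + m + U ≤ Y (bAt i m)
    b-gap gap = ladder-lower (λ m → Y (bAt i m)) (λ m → 2 * Q + ρ + m + U) (λ m → suc-+ (2 * Q + ρ) m U)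
      (b-step (λ m → ≤-refl)) (subst (λ v → 2 * Q + ρ + ρ + U ≤ Y v) (sym (bAt-ρ i)) gap)

    b-unset : 2 * Q + ρ + ρ + U ≤ W → ∀ j → T (b1 i j) ≢ true
    b-unset gap j Te = no-climb {x = 2 * Q + ρ} {toℕ j} {U} eq (b-gap gap (suc (toℕ j)) (Fin.toℕ<n j)) (b≤ j)
      where
      eq : Y (bAt i (toℕ j)) ≡ Y (bAt i (suc (toℕ j)))
      eq = trans (cong Y (bAt-toℕ i j)) (yN-tail tree Te)

    private
      Q≤2Q : Q ≤ 2 * Q
      Q≤2Q = m≤n*m Q 2

    eq-set : U ≡ W → AllB F i → ∀ {j} → Chain F i j → Y (u i) ≡ Y (w i)
    eq-set U≡W allB {j} ch = trans (≤-antisym u≤U U≤u) (≤-antisym U≤w w≤U)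
      where
      b0≤U = ≤-trans (b-complete allB 0 z≤n) (≤-reflexive (sym U≡W))
      U≤b0 = b-lower ≤-refl (≤-reflexive U≡W) 0 z≤n
      u≤U : Y (u i) ≤ U
      u≤U = ≤-trans u≤b b0≤U
      w≤U : Y (w i) ≤ U
      w≤U = ≤-trans (w≤a j) (≤-trans (a-complete ch 0 z≤n) b0≤U)
      U≤u : U ≤ Y (u i)
      U≤u with out-u
      ... | inj₁ eq = ≤-trans U≤b0 (≤-reflexive (sym eq))
      ... | inj₂ eq = ≤-trans (m≤n+m U Q) (≤-reflexive (sym eq))
      U≤w : U ≤ Y (w i)
      U≤w with out-w
      ... | inj₁ (j' , eq) = ≤-trans (a-lower (m≤n+m U (2 * Q)) U≤b0 j' 0 z≤n) (≤-reflexive (sym eq))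
      ... | inj₂ eq = ≤-trans (≤-reflexive U≡W) (≤-trans (m≤n+m W Q) (≤-reflexive (sym eq)))

    -- Both vertices take their own zero-edge of cost Q, as any route through the a's or b's is
    -- dearer by at least another Q.
    eq-unset : U ≡ W → 2 * Q + ρ + U ≤ Y (bAt i 0) → Y (u i) ≡ Y (w i)
    eq-unset U≡W lo = trans (≤-antisym u≤ QU≤u) (≤-antisym QU≤w (subst (λ x → Y (w i) ≤ Q + x) (sym U≡W) w≤))
      where
      2QU≤b0 : 2 * Q + U ≤ Y (bAt i 0)
      2QU≤b0 = ≤-trans (+-monoˡ-≤ U (m≤m+n (2 * Q) ρ)) lo
      QU≤2QU : Q + U ≤ 2 * Q + U
      QU≤2QU = +-monoˡ-≤ U Q≤2Q
      QU≤u : Q + U ≤ Y (u i)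
      QU≤u with out-u
      ... | inj₁ eq = ≤-trans QU≤2QU (≤-trans 2QU≤b0 (≤-reflexive (sym eq)))
      ... | inj₂ eq = ≤-reflexive (sym eq)
      QU≤w : Q + U ≤ Y (w i)
      QU≤w with out-w
      ... | inj₁ (j' , eq) = ≤-trans QU≤2QU (≤-trans (a-lower ≤-refl 2QU≤b0 j' 0 z≤n) (≤-reflexive (sym eq)))
      ... | inj₂ eq = ≤-trans (≤-reflexive (cong (Q +_) U≡W)) (≤-reflexive (sym eq))

    w-gap : ∀ {x} → x ≤ U → U ≤ W → (∀ j → 2 * Q + U ≤ Y (aAt i j 0)) → Q + x ≤ Y (w i)
    w-gap x≤U U≤W lo with out-w
    ... | inj₁ (j , eq) = ≤-trans (+-mono-≤ Q≤2Q x≤U) (≤-trans (lo j) (≤-reflexive (sym eq)))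
    ... | inj₂ eq = ≤-trans (+-monoʳ-≤ Q (≤-trans x≤U U≤W)) (≤-reflexive (sym eq))

    -- uᵢ enters the b's for free and pays at most `W = U`. wᵢ pays either Q at `w0`, or at least
    -- `2 * Q` for leaving a broken chain or what precedes its missing edge.
    eq-nochain : U ≡ W → AllB F i → (∀ j → ∃ λ k → T (a1 i j k) ≢ true) → Q + Y (u i) ≤ Y (w i)
    eq-nochain U≡W allB noch = w-gap
      (≤-trans u≤b (≤-trans (b-complete allB 0 z≤n) (≤-reflexive (sym U≡W)))) (≤-reflexive U≡W)
      λ j → a-incomplete j (proj₁ (noch j)) (proj₂ (noch j)) 0 z≤n

    -- The purpose of the factor 4 between consecutive levels: `4 * Q` is `2 * Q` plus two further
    -- Q, each at least ρ, and `2 * Q + ρ + ρ` makes even the full row of b's unattractive.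
    gap-bound : q (suc (toℕ i)) + U ≤ W → 2 * Q + ρ + ρ + U ≤ W
    gap-bound gap = ≤-trans (+-monoˡ-≤ U le) gap
      where
      open ≤-Reasoning
      le : 2 * Q + ρ + ρ ≤ q (suc (toℕ i))
      le = begin
        2 * Q + ρ + ρ   ≤⟨ +-mono-≤ (+-monoʳ-≤ (2 * Q) (ρ≤q (toℕ i))) (ρ≤q (toℕ i)) ⟩
        2 * Q + Q + Q   ≡⟨ solve 1 (λ Q → con 2 :* Q :+ Q :+ Q := con 4 :* Q) refl Q ⟩
        4 * Q           ≡⟨ sym (q-suc (toℕ i)) ⟩
        q (suc (toℕ i)) ∎
        where open +-*-Solver

    gap-b0 : q (suc (toℕ i)) + U ≤ W → 2 * Q + ρ + U ≤ Y (bAt i 0)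
    gap-b0 gap = ≤-trans (+-monoˡ-≤ U (m≤m+n (2 * Q + ρ) 0)) (b-gap (gap-bound gap) 0 z≤n)

    -- uᵢ escapes for at most `Q + U`. wᵢ either passes the gap on through `w0`, paying `Q + W`, or
    -- goes through some a's and pays at least `2 * Q + U`.
    gap-down : q (suc (toℕ i)) + U ≤ W → Q + Y (u i) ≤ Y (w i)
    gap-down gap with out-w
    ... | inj₂ eq = ≤-trans (+-monoʳ-≤ Q (≤-trans u≤ (≤-trans (+-monoˡ-≤ U Q≤q) gap))) (≤-reflexive (sym eq))
      where Q≤q : Q ≤ q (suc (toℕ i))
            Q≤q = ≤-trans (m≤n*m Q 4) (≤-reflexive (sym (q-suc (toℕ i))))
    ... | inj₁ (j , eq) = begin
        Q + Y (u i)     ≤⟨ +-monoʳ-≤ Q u≤ ⟩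
        Q + (Q + U)     ≡⟨ solve 2 (λ Q U → Q :+ (Q :+ U) := con 2 :* Q :+ U) refl Q U ⟩
        2 * Q + U       ≤⟨ a-lower ≤-refl (≤-trans (+-monoˡ-≤ U (m≤m+n (2 * Q) ρ)) (gap-b0 gap)) j 0 z≤n ⟩
        Y (aAt i j 0)   ≡⟨ sym eq ⟩
        Y (w i)         ∎
      where open ≤-Reasoning
            open +-*-Solver

-- Propagation across levels and the invariants of a run

module Counting (n r s t : ℕ) .{{r≢0 : NonZero r}} .{{s≢0 : NonZero s}} where

  open Levels n r s t {{r≢0}} {{s≢0}} public

  pos : List Ed → Ed → ℕ
  pos [] e = 0
  pos (x ∷ xs) e = if eqE x e then 0 else suc (pos xs e)

  firstOut-first : ∀ ord F B {g} → firstOut ord F B ≡ just g →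
                   ∀ e → F e ≡ true → B e ≢ true → pos ord g ≤ pos ord e
  firstOut-first (x ∷ xs) F B {g} eq e Fe Be with F x ∧ not (B x) in px
  firstOut-first (x ∷ xs) F B refl e Fe Be | true rewrite eqE-refl x = z≤n
  ... | false with eqE x e in xe
  ...   | true with refl ← eqE-sound x e xe | B x
  ...     | true  = ⊥-elim (Be refl)
  ...     | false rewrite Fe with () ← px
  firstOut-first (x ∷ xs) F B {g} eq e Fe Be | false | false with eqE x g
  ... | true  = z≤n
  ... | false = s≤s (firstOut-first xs F B eq e Fe Be)

  all-b? : ∀ F i → Dec (AllB F i)
  all-b? F i = Fin.all? λ j → F (b1 i j) Bool.≟ true

  chain? : ∀ F i → Dec (∃ λ j → Chain F i j)
  chain? F i = Fin.any? λ j → Fin.all? λ k → F (a1 i j k) Bool.≟ true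

  missing : ∀ {m} {f : Fin m → Bool} → ¬ (∀ j → f j ≡ true) → ∃ λ j → f j ≢ true
  missing {m} {f} = Fin.¬∀⟶∃¬ m (λ j → f j ≡ true) (λ j → f j Bool.≟ true)

  ∉-⊑ : ∀ {O F e} → O ⊑ F → F e ≢ true → O e ≢ true
  ∉-⊑ O⊑F ¬Fe Oe = ¬Fe (O⊑F _ Oe)

  EqAt GapAt : EdgeSet → ℕ → Set
  EqAt T m  = yN T (uAt m) ≡ yN T (wAt m)
  GapAt T m = q m + yN T (uAt m) ≤ yN T (wAt m)

  module _ {F T : EdgeSet} (rich : Rich F) (opt : Opt F T) where

    eq-down : ∀ {m} → m ≤ n → (∀ i → toℕ i < m → AllB F i → ∃ λ j → Chain F i j) →
              EqAt T m → ∀ l → l ≤ m → EqAt T l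
    eq-down {m} m≤n chains eqm = ladder-ind m (EqAt T) eqm
      λ l l<m → from-Fin (λ l → l < m → EqAt T (suc l) → EqAt T l) step l (<-≤-trans l<m m≤n) l<m
      where
      step : ∀ (i : Fin n) → toℕ i < m → EqAt T (suc (toℕ i)) → EqAt T (toℕ i)
      step i i<m eq rewrite uAt-toℕ i | wAt-toℕ i with all-b? F i
      ... | yes allB = At.eq-set rich opt i eq allB (proj₂ (chains i i<m allB))
      ... | no ¬allB with j , ¬Fj ← missing ¬allB =
        At.eq-unset rich opt i eq (At.b-incomplete rich opt i j (∉-⊑ (Opt.inside opt) ¬Fj) 0 z≤n)

    gap-down-all : ∀ {m} → m ≤ n → GapAt T m → ∀ l → l ≤ m → GapAt T l
    gap-down-all {m} m≤n gapm = ladder-ind m (GapAt T) gapm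
      λ l l<m → from-Fin (λ l → GapAt T (suc l) → GapAt T l) step l (<-≤-trans l<m m≤n)
      where
      step : ∀ (i : Fin n) → GapAt T (suc (toℕ i)) → GapAt T (toℕ i)
      step i gap rewrite uAt-toℕ i | wAt-toℕ i = At.gap-down rich opt i gap

    gap-reset : ∀ {m} → m ≤ n → GapAt T m → ∀ i → toℕ i < m →
                (∀ j k → T (a1 i j k) ≢ true) × (∀ j → T (b1 i j) ≢ true)
    gap-reset m≤n gapm i i<m = a-unset (gap-b0 gap) , b-unset (gap-bound gap)
      where
      open At rich opt i
      gap = gap-down-all m≤n gapm (suc (toℕ i)) i<m

  module _ (ord : List Ed) where

    -- An edge positioned no later than every edge of some chain is not late. The invariants below
    -- put each removed edge in such a position, so late edges stay in F throughout the counted part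
    -- of the run and F stays `Rich`.
    Late : Ed → Set
    Late e = ∀ i j → ∃ λ k → pos ord (a1 i j k) < pos ord e

    record GoodOrder : Set where
      field
        late-u0 : ∀ i → ∃ λ l → Late (u0 i l)
        late-w0 : ∀ i → ∃ λ l → Late (w0 i l)
        late-a0 : ∀ i j k → ∃ λ l → Late (a0 i j k l)
        late-b0 : ∀ i j → ∃ λ l → Late (b0 i j l)
        late-u1 : ∀ i → ∃ λ l → Late (u1 i l)
        late-wj : ∀ i j → ∃ λ l → Late (wj i j l)
        b-first : ∀ i → ∃₂ λ j j* → ∀ k → pos ord (b1 i j*) < pos ord (a1 i j k)

    Precedes : Fin n → Fin n → Set
    Precedes d d' = ∀ j' → ∃ λ j → pos ord (b1 d j) < pos ord (b1 d' j')

    data Descending : ℕ → List (Fin n) → Set where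
      []  : ∀ {m} → Descending m []
      add : ∀ {m d D} → toℕ d < m → All (Precedes d) D → Descending (toℕ d) D → Descending m (d ∷ D)

    Descending-weaken : ∀ {m m' D} → m ≤ m' → Descending m D → Descending m' D
    Descending-weaken le [] = []
    Descending-weaken le (add d<m fst D) = add (≤-trans d<m le) fst D

    LateChain : EdgeSet → Fin n → Set
    LateChain F i = ∃₂ λ j j* → Chain F i j × (∀ k → pos ord (b1 i j*) < pos ord (a1 i j k))

    Inv : ℕ → EdgeSet → Set
    Inv m F = ∀ i → toℕ i < m → AllB F i → LateChain F i

    -- The two values above level d are frozen: later trees are no dearer, they lie inside F, and no
    -- tree inside F does better. Their equality therefore persists without further knowledge of the
    -- higher levels.
    record Lock (F B : EdgeSet) (d : Fin n) : Set where
      field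
        eq  : EqAt B (suc (toℕ d))
        low : ∀ T → IsTree T → T ⊑ F →
              (yN B (uAt (suc (toℕ d))) ≤ yN T (uAt (suc (toℕ d)))) × (yN B (wAt (suc (toℕ d))) ≤ yN T (wAt (suc (toℕ d))))

    lock-mono : ∀ {F F' B O d} → Lock F B d → IsTree O → O ⊑ F → (∀ v → yN O v ≤ yN B v) → F' ⊑ F → Lock F' O d
    lock-mono {d = d} lock treeO O⊑F O≤B F'⊑F = record
      { eq  = trans equ (trans (Lock.eq lock) (sym eqw))
      ; low = λ T treeT T⊑F' → let lu , lw = Lock.low lock T treeT (⊑-trans T⊑F' F'⊑F) in
                ≤-trans (≤-reflexive equ) lu , ≤-trans (≤-reflexive eqw) lw }
      where
      equ = ≤-antisym (O≤B _) (proj₁ (Lock.low lock _ treeO O⊑F))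
      eqw = ≤-antisym (O≤B _) (proj₂ (Lock.low lock _ treeO O⊑F))

    -- Why the values at u_m and w_m agree in an optimal tree for F.
    data Ctx (F B : EdgeSet) : ℕ → Set where
      top : Ctx F B n
      mid : ∀ d → Lock F B d → AllB B d → (∃ λ j → Chain F d j) → Ctx F B (toℕ d)

    Ctx-≤ : ∀ {F B m} → Ctx F B m → m ≤ n
    Ctx-≤ top = ≤-refl
    Ctx-≤ (mid d _ _ _) = <⇒≤ (Fin.toℕ<n d)

    -- The counting phase. Below m no b-edge is in B, so those in F are all candidates for removal
    -- and the next removed edge is no later than any of them. Through `inv` this protects a chain
    -- at every level with all its b-edges.
    record State (F B : EdgeSet) (m : ℕ) : Set where
      field
        tree    : IsTree B
        inside  : B ⊑ F
        late    : ∀ e → Late e → F e ≡ true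
        inv     : Inv m F
        reset-a : ∀ i → toℕ i < m → ∀ j k → B (a1 i j k) ≢ true
        reset-b : ∀ i → toℕ i < m → ∀ j → B (b1 i j) ≢ true

    -- The last missing b-edge of level d has just been inserted, and the lower levels are not yet reset.
    record Pending (F C : EdgeSet) (d : Fin n) : Set where
      field
        tree   : IsTree C
        inside : C ⊑ F
        late   : ∀ e → Late e → F e ≡ true
        lock   : Lock F C d
        all-b  : AllB F d
        chain  : ∃ λ j → Chain F d j
        no-a   : ∀ j k → C (a1 d j k) ≢ true
        ret    : ∀ i → toℕ i < toℕ d → AllB F i → AllB C i × LateChain C i

    module _ (good : GoodOrder) where

      rich : ∀ {F} → (∀ e → Late e → F e ≡ true) → Rich F
      rich late = record
        { has-u0 = λ i → let l , p = late-u0 i in l , late _ p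
        ; has-w0 = λ i → let l , p = late-w0 i in l , late _ p
        ; has-a0 = λ i j k → let l , p = late-a0 i j k in l , late _ p
        ; has-b0 = λ i j → let l , p = late-b0 i j in l , late _ p
        ; has-u1 = λ i → let l , p = late-u1 i in l , late _ p
        ; has-wj = λ i j → let l , p = late-wj i j in l , late _ p }
        where open GoodOrder good

      module Step {F B O : EdgeSet} {g : Ed} {k : ℕ} (tree : IsTree B) (inside : B ⊑ F)
                  (late : ∀ e → Late e → F e ≡ true)
                  (fo : firstOut ord F B ≡ just g) (inner : RF ord (remove F g) B O k) where

        F' : EdgeSet
        F' = remove F g

        Fg : F g ≡ true
        Fg = proj₁ (firstOut-sound ord F B fo)

        inside' : B ⊑ F'
        inside' = ⊑-remove g inside (proj₂ (firstOut-sound ord F B fo))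

        first : ∀ e → F e ≡ true → B e ≢ true → pos ord g ≤ pos ord e
        first = firstOut-first ord F B fo

        opt : Opt F' O
        opt = proj₁ (RF-opt inner tree inside')

        O≤B : ∀ v → yN O v ≤ yN B v
        O≤B = proj₂ (RF-opt inner tree inside')

        O⊑F : O ⊑ F
        O⊑F = ⊑-trans (Opt.inside opt) (remove-⊑ F g)

        Og : O g ≢ true
        Og Og≡ = remove-≢ F g g (Opt.inside opt g Og≡) refl

        -- The source of all forced switches: without a switch O would be optimal for F and would
        -- have to contain g, against `Og`.
        opt-skip : ¬ Improving O g → Opt F O
        opt-skip nimp = proj₁ (RF-opt (skip fo inner nimp) tree inside)

        not-late : ∀ {i j} → (∀ k → pos ord g ≤ pos ord (a1 i j k)) → ¬ Late g
        not-late {i} {j} le l with k , lt ← l i j = <-irrefl refl (<-≤-trans lt (le k))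

        keep-late : ¬ Late g → ∀ e → Late e → F' e ≡ true
        keep-late ¬l e l = remove-keep F g e (late e l) λ { refl → ¬l l }

        keep-b : ∀ {d} → (∀ j → g ≢ b1 d j) → AllB F d → AllB F' d
        keep-b g≢ allB j = remove-keep F g _ (allB j) λ eq → g≢ j (sym eq)

        -- Here g is the edge whose absence breaks the last chain of level d. Without it
        -- `eq-nochain` creates the gap at d, so O has reset all lower levels, and inserting g
        -- changes none of them: counting starts afresh below d, with level d as its context. The
        -- double negation suffices against a `skip`; a `take` brings its own proof of improvement.
        restart : ∀ {d} → (∀ e → Late e → F' e ≡ true) → Inv (toℕ d) F → Lock F B d →
                  AllB F' d → (∃ λ j → Chain F d j) → ¬ (∃ λ j → Chain F' d j) →
                  (¬ ¬ Improving O g) × (Improving O g → State F (switch O g) (toℕ d) × Ctx F (switch O g) (toℕ d))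
        restart {d} late' inv lock allB (j , ch) ¬ch = (λ nimp → Og (Og≡ nimp)) , λ imp →
          record
            { tree    = switch-tree (Opt.tree opt) g
            ; inside  = switch-⊑ O⊑F g Fg
            ; late    = late
            ; inv     = inv
            ; reset-a = λ i i<d j' k' → ra i i<d j' k' (switch-cases O g (a1 i j' k'))
            ; reset-b = λ i i<d j' → rb i i<d j' (switch-cases O g (b1 i j')) } ,
          mid d (lock-mono lock (switch-tree (Opt.tree opt) g) (switch-⊑ O⊑F g Fg)
                   (λ v → ≤-trans (switch-≤ (Opt.tree opt) (improving⇒N O g imp) v) (O≤B v)) (λ _ p → p))
                (λ j' → switch-old O g (b1 d j') (b-set (≤-reflexive (sym U≡W)) allB j') (subst (λ e → b d j' ≢ tail e) (sym g≡) λ ()))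
                (j , ch)
          where
          lockO : Lock F O d
          lockO = lock-mono lock (Opt.tree opt) O⊑F O≤B λ _ p → p
          U≡W : EqAt O (suc (toℕ d))
          U≡W = Lock.eq lockO
          open At (rich late') opt d
          lost : ∃ λ k → F' (a1 d j k) ≢ true
          lost = missing λ ch' → ¬ch (j , ch')
          g≡ : g ≡ a1 d j (proj₁ lost)
          g≡ with a1 d j (proj₁ lost) ≟E g
          ... | yes eq = sym eq
          ... | no ne = ⊥-elim (proj₂ lost (remove-keep F g _ (ch _) ne))
          Og≡ : ¬ Improving O g → O g ≡ true
          Og≡ nimp = subst (λ e → O e ≡ true) (sym g≡) (At.a-set (rich late) (opt-skip nimp) d (≤-reflexive (sym U≡W))
            (λ j' → remove-⊑ F g _ (allB j')) ch (proj₁ lost))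
          gap : GapAt O (toℕ d)
          gap rewrite uAt-toℕ d | wAt-toℕ d = eq-nochain U≡W allB
            λ j' → let k' , ne = missing (λ ch' → ¬ch (j' , ch')) in k' , ∉-⊑ (Opt.inside opt) ne
          reset : ∀ i → toℕ i < toℕ d → _
          reset = gap-reset (rich late') opt (<⇒≤ (Fin.toℕ<n d)) gap
          ra : ∀ i → toℕ i < toℕ d → ∀ j' k' → (switch O g (a1 i j' k') ≡ true → _) → switch O g (a1 i j' k') ≢ true
          ra i i<d j' k' cases p with cases p
          ... | inj₂ (Oe , _) = proj₁ (reset i i<d) j' k' Oe
          ... | inj₁ eq with refl ← trans eq g≡ = <-irrefl refl i<d
          rb : ∀ i → toℕ i < toℕ d → ∀ j' → (switch O g (b1 i j') ≡ true → _) → switch O g (b1 i j') ≢ true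
          rb i i<d j' cases p with cases p
          ... | inj₂ (Oe , _) = proj₂ (reset i i<d) j' Oe
          ... | inj₁ eq with () ← trans eq g≡

-- Counting switches

module SwitchCount (n r s t : ℕ) .{{r≢0 : NonZero r}} .{{s≢0 : NonZero s}} where

  open Counting n r s t {{r≢0}} {{s≢0}} public

  module _ (ord : List Ed) (good : GoodOrder ord) where

    private
      is-b : ∀ d g → Dec (∃ λ j → g ≡ b1 d j)
      is-b d g = Fin.any? λ j → g ≟E b1 d j

      first-steps : ∀ {k k' x} → x ≤ suc k → x ≤ suc (k + suc k')
      first-steps {k} le = ≤-trans le (s≤s (m≤m+n k _))

      last-steps : ∀ {k k' x} → x ≤ suc k' → x ≤ suc (k + suc k')
      last-steps {k} {k'} le = ≤-trans le (m≤n⇒m≤1+n (m≤n+m (suc k') k))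

      both-steps : ∀ {k k' x} → x ≤ suc k → x ≤ suc k' → 2 * x ≤ suc (k + suc k')
      both-steps {x = x} le le' = +-mono-≤ le (≤-trans (≤-reflexive (+-identityʳ x)) le')

    -- Bounding `suc k` makes the induction exact: a `take` with `k + suc k'` switches yields
    -- `suc k + suc k'`. The head of D is the level of D that loses a b-edge first; when it does,
    -- the inner and the outer call both count the rest of D.
    count : ∀ {F B B' k m D} → RF ord F B B' k → State ord F B m → Ctx ord F B m →
            Descending ord m D → All (AllB F) D → 2 ^ length D ≤ suc k

    -- Further b-edges of level d and unrelated edges only prolong the phase. The bound is collected
    -- from `count` when `restart` applies, which must happen because a chain of F is still outside
    -- the tree.
    count-pending : ∀ {F C B' k d D} → RF ord F C B' k → Pending ord F C d →
                    Descending ord (toℕ d) D → All (AllB F) D → 2 ^ length D ≤ suc k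

    module Count {F B O g k m d} (fo : firstOut ord F B ≡ just g) (inner : RF ord (remove F g) B O k)
                 (st : State ord F B m) (d<m : toℕ d < m) (allB : AllB F d) where

      open State st
      open Step ord good tree inside late fo inner public

      first-b : ∀ i → toℕ i < m → AllB F i → ∀ j → pos ord g ≤ pos ord (b1 i j)
      first-b i i<m allB j = first (b1 i j) (allB j) (reset-b i i<m j)

      late' : ∀ e → Late ord e → F' e ≡ true
      late' with j , j* , ch , lt ← inv d d<m allB =
        keep-late (not-late {d} {j} λ k → ≤-trans (first-b d d<m allB j*) (<⇒≤ (lt k)))

      inv' : Inv ord m F'
      inv' i i<m allB' = let allB = λ j → remove-⊑ F g _ (allB' j)
                             j , j* , ch , lt = inv i i<m allB in
        j , j* , (λ k → remove-keep F g _ (ch k) λ eq → <-irrefl (cong (pos ord) (sym eq)) (≤-<-trans (first-b i i<m allB j*) (lt k))) , lt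

      state' : State ord F' B m
      state' = record { tree = tree ; inside = inside' ; late = late' ; inv = inv' ; reset-a = reset-a ; reset-b = reset-b }

      ctx-keep : Ctx ord F B m → (∀ i → (∃ λ j → Chain F i j) → ∃ λ j → Chain F' i j) → Ctx ord F' B m
      ctx-keep top _ = top
      ctx-keep (mid d lock allB ch) keep = mid d (lock-mono ord lock tree inside (λ _ → ≤-refl) (remove-⊑ F g)) allB (keep d ch)

      eq-m : Ctx ord F' B m → EqAt O m
      eq-m top rewrite uAt-n | wAt-n = refl
      eq-m (mid d lock allB (_ , ch)) rewrite uAt-toℕ d | wAt-toℕ d =
        At.eq-set (rich ord good late') opt d
          (Lock.eq (lock-mono ord lock (Opt.tree opt) (Opt.inside opt) O≤B λ _ p → p)) (λ j → inside' _ (allB j)) ch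

      eq-below : m ≤ n → Ctx ord F' B m → ∀ l → l ≤ m → EqAt O l
      eq-below m≤n ctx = eq-down (rich ord good late') opt m≤n
        (λ i i<m allB → let j , _ , ch , _ = inv' i i<m allB in j , ch) (eq-m ctx)

      -- g is no later than the first b-edge of d, which precedes every b-edge of the other levels
      -- in D; so removing g costs none of them a b-edge.
      other-b : ∀ {D} → (∀ j → g ≢ b1 d j) → All (Precedes ord d) D → All (AllB F) D → All (AllB F') (d ∷ D)
      other-b ne fsts allBs = keep-b ne allB ∷ go fsts allBs
        where
        go : ∀ {D} → All (Precedes ord d) D → All (AllB F) D → All (AllB F') D
        go [] [] = []
        go {d' ∷ _} (fst ∷ fsts) (allB' ∷ allBs) =
          keep-b {d'} (λ j' eq → let j , lt = fst j' in <-irrefl (cong (pos ord) eq) (≤-<-trans (first-b d d<m allB j) lt)) allB'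
          ∷ go fsts allBs

      -- The removed edge may break the last chain of the level that serves as context. Then the
      -- inner call is given up and the whole list is counted in the outer call, after the reset.
      continue : Ctx ord F B m → Ctx ord F' B m ⊎
        ((¬ ¬ Improving O g) × (Improving O g → State ord F (switch O g) m × Ctx ord F (switch O g) m))
      continue top = inj₁ top
      continue (mid d₀ lock allB₀ ch) with chain? F' d₀
      ... | yes ch' = inj₁ (mid d₀ (lock-mono ord lock tree inside (λ _ → ≤-refl) (remove-⊑ F g)) allB₀ ch')
      ... | no ¬ch  = inj₂ (restart late' inv lock (λ j → inside' _ (allB₀ j)) ch ¬ch)

      module Bit (j : Fin (r * s)) (g≡ : g ≡ b1 d j) (m≤n : m ≤ n) (ctx : Ctx ord F B m) where

        ctx' : Ctx ord F' B m
        ctx' = ctx-keep ctx λ i (j , ch) → j , λ k → remove-keep F g _ (ch k) λ eq → distinct-edges (trans eq g≡)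
          where distinct-edges : ∀ {i j k d j'} → a1 i j k ≢ b1 d j'
                distinct-edges ()

        other-d : ∀ {D} → Descending ord (toℕ d) D → All (AllB F) D → All (AllB F') D
        other-d = go ≤-refl
          where
          go : ∀ {D x} → x ≤ toℕ d → Descending ord x D → All (AllB F) D → All (AllB F') D
          go x≤d [] [] = []
          go x≤d (add {d = d'} lt _ ds) (allB ∷ allBs) =
            keep-b {d'} (λ j' eq → distinct-edges (trans (sym eq) g≡) (<-≤-trans lt x≤d)) allB
            ∷ go (<⇒≤ (<-≤-trans lt x≤d)) ds allBs
            where distinct-edges : ∀ {d' j'} → b1 d' j' ≡ b1 d j → toℕ d' < toℕ d → ⊥
                  distinct-edges refl lt = <-irrefl refl lt

        private
          richO = rich ord good late'

        eqs : ∀ l → l ≤ m → EqAt O l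
        eqs = eq-below m≤n ctx'

        U≡W : EqAt O (suc (toℕ d))
        U≡W = eqs _ d<m

        Ob : O (b1 d j) ≢ true
        Ob = subst (λ e → O e ≢ true) g≡ Og

        no-skip : ¬ ¬ Improving O g
        no-skip nimp = Ob (At.b-set (rich ord good late) (opt-skip nimp) d (≤-reflexive (sym U≡W)) allB j)

        module _ (imp : Improving O g) where

          C : EdgeSet
          C = switch O g

          private
            -- The tail of g has larger rank than the vertices in question, so on these optimality
            -- without g is already optimality in F. This provides the `Lock` for level d.
            lower-edge : ∀ v → rank v ≤ (n ∸ suc (toℕ d)) * P → ∀ T → IsTree T → T ⊑ F → yN O v ≤ yN T v
            lower-edge v rk T treeT T⊑F = yN-lower treeT ((n ∸ suc (toℕ d)) * P) (yN O) (yN-tgt O)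
              (λ e Te rk → Opt.minimal opt e (remove-keep F g e (T⊑F e Te) λ eq → high (subst (λ e → rank (tail e) ≤ _) eq rk))) v rk
              where
              high : ¬ (rank (tail g) ≤ (n ∸ suc (toℕ d)) * P)
              high rk rewrite g≡ = <-irrefl refl (<-≤-trans (m<m+n _ (m<n⇒0<n∸m (Fin.toℕ<n j))) rk)

            same : ∀ v → rank v ≤ (n ∸ suc (toℕ d)) * P → yN C v ≡ yN O v
            same v rk = ≤-antisym (switch-≤ (Opt.tree opt) (improving⇒N O g imp) v)
              (lower-edge v rk C (switch-tree (Opt.tree opt) g) (switch-⊑ O⊑F g Fg))

            rku = ≤-reflexive (rank-uAt (suc (toℕ d)))
            rkw = ≤-reflexive (rank-wAt (suc (toℕ d)))

          pending : Pending ord F C d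
          pending = record
            { tree   = switch-tree (Opt.tree opt) g
            ; inside = switch-⊑ O⊑F g Fg
            ; late   = late
            ; lock   = record
              { eq = trans (same _ rku) (trans U≡W (sym (same _ rkw)))
              ; low = λ T treeT T⊑F → ≤-trans (≤-reflexive (same _ rku)) (lower-edge _ rku T treeT T⊑F)
                                    , ≤-trans (≤-reflexive (same _ rkw)) (lower-edge _ rkw T treeT T⊑F) }
            ; all-b  = allB
            ; chain  = let j , _ , ch , _ = inv d d<m allB in j , ch
            ; no-a   = λ j' k' → no-a j' k' (switch-cases O g (a1 d j' k'))
            ; ret    = ret }
            where
            no-a : ∀ j' k' → (C (a1 d j' k') ≡ true → _) → C (a1 d j' k') ≢ true
            no-a j' k' cases p with cases p
            ... | inj₁ eq with () ← trans eq g≡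
            ... | inj₂ (Oe , _) = At.a-unset richO opt d (At.b-incomplete richO opt d j Ob 0 z≤n) j' k' Oe
            ret : ∀ i → toℕ i < toℕ d → AllB F i → AllB C i × LateChain ord C i
            ret i i<d allBi = (λ j' → switch-old O g _ (b-set W≤U allBi' j') (subst (λ e → b i j' ≢ tail e) (sym g≡) λ { refl → <-irrefl refl i<d }))
                            , (jᵢ , j* , (λ k' → switch-old O g _ (a-set W≤U allBi' ch k') (subst (λ e → a i jᵢ k' ≢ tail e) (sym g≡) λ ())) , lt)
              where
              open At richO opt i using (b-set; a-set)
              allBi' : AllB F' i
              allBi' = keep-b {i} (λ j' eq → distinct-edges (trans (sym eq) g≡)) allBi
                where distinct-edges : ∀ {j'} → b1 i j' ≢ b1 d j
                      distinct-edges refl = <-irrefl refl i<d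
              W≤U = ≤-reflexive (sym (eqs (suc (toℕ i)) (<-trans i<d d<m)))
              late-chain = inv' i (<-trans i<d d<m) allBi'
              jᵢ = proj₁ late-chain
              j* = proj₁ (proj₂ late-chain)
              ch = proj₁ (proj₂ (proj₂ late-chain))
              lt = proj₂ (proj₂ (proj₂ late-chain))

    module CountPending {F C O g k d} (fo : firstOut ord F C ≡ just g) (inner : RF ord (remove F g) C O k)
                        (pd : Pending ord F C d) where

      open Pending pd
      open Step ord good tree inside late fo inner public

      late' : ∀ e → Late ord e → F' e ≡ true
      late' = keep-late (not-late {d} {proj₁ chain} λ k → first _ (proj₂ chain k) (no-a _ k))

      lockO : Lock ord F' O d
      lockO = lock-mono ord lock (Opt.tree opt) O⊑F O≤B (remove-⊑ F g)

      -- By `ret` the complete levels below d are held by the current tree, and an edge of the tree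
      -- is never removed. No assumption on the ordering of their b-edges enters in this phase.
      below : ∀ {D x} → x ≤ toℕ d → Descending ord x D → All (AllB F) D → All (AllB F') D
      below x≤d [] [] = []
      below x≤d (add {d = d'} lt _ ds) (allB ∷ allBs) =
        (λ j → inside' _ (proj₁ (ret d' (<-≤-trans lt x≤d) allB) j)) ∷ below (<⇒≤ (<-≤-trans lt x≤d)) ds allBs

      ret' : ∀ i → toℕ i < toℕ d → AllB F' i → AllB C i × LateChain ord C i
      ret' i i<d allB' = ret i i<d λ j → remove-⊑ F g _ (allB' j)

      inv : Inv ord (toℕ d) F
      inv i i<d allB = let _ , j , j* , ch , lt = ret i i<d allB in j , j* , (λ k → inside _ (ch k)) , lt

      pending' : AllB F' d → (∃ λ j → Chain F' d j) → Pending ord F' C d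
      pending' allB' ch' = record
        { tree = tree ; inside = inside' ; late = late'
        ; lock = lock-mono ord lock tree inside (λ _ → ≤-refl) (remove-⊑ F g)
        ; all-b = allB' ; chain = ch' ; no-a = no-a ; ret = ret' }

      continue : (∀ j → g ≢ b1 d j) → Pending ord F' C d ⊎
        ((¬ ¬ Improving O g) × (Improving O g → State ord F (switch O g) (toℕ d) × Ctx ord F (switch O g) (toℕ d)))
      continue ne with chain? F' d
      ... | yes ch' = inj₁ (pending' (keep-b ne all-b) ch')
      ... | no ¬ch  = inj₂ (restart late' inv lock (keep-b ne all-b) chain ¬ch)

      module Bit (j : Fin (r * s)) (g≡ : g ≡ b1 d j) where

        private
          richO = rich ord good late'

        Ob : O (b1 d j) ≢ true
        Ob = subst (λ e → O e ≢ true) g≡ Og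

        b0-high : _
        b0-high = At.b-incomplete richO opt d j Ob 0 z≤n

        no-skip : ¬ ¬ Improving O g
        no-skip nimp = Ob (At.b-set (rich ord good late) (opt-skip nimp) d (≤-reflexive (sym (Lock.eq lockO))) all-b j)

        eqs : ∀ l → l ≤ toℕ d → EqAt O l
        eqs = eq-down richO opt (<⇒≤ (Fin.toℕ<n d))
          (λ i i<d allB' → let _ , j , _ , ch , _ = ret' i i<d allB' in j , λ k → inside' _ (ch k)) eq-d
          where
          eq-d : EqAt O (toℕ d)
          eq-d rewrite uAt-toℕ d | wAt-toℕ d = At.eq-unset richO opt d (Lock.eq lockO) b0-high

        pending : Improving O g → Pending ord F (switch O g) d
        pending imp = record
          { tree = switch-tree (Opt.tree opt) g
          ; inside = switch-⊑ O⊑F g Fg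
          ; late = late
          ; lock = lock-mono ord lock (switch-tree (Opt.tree opt) g) (switch-⊑ O⊑F g Fg)
                     (λ v → ≤-trans (switch-≤ (Opt.tree opt) (improving⇒N O g imp) v) (O≤B v)) (λ _ p → p)
          ; all-b = all-b
          ; chain = chain
          ; no-a = λ j' k' → no-a₁ j' k' (switch-cases O g (a1 d j' k'))
          ; ret = ret₁ }
          where
          no-a₁ : ∀ j' k' → (switch O g (a1 d j' k') ≡ true → _) → switch O g (a1 d j' k') ≢ true
          no-a₁ j' k' cases p with cases p
          ... | inj₁ eq with () ← trans eq g≡
          ... | inj₂ (Oe , _) = At.a-unset richO opt d b0-high j' k' Oe
          ret₁ : ∀ i → toℕ i < toℕ d → AllB F i → AllB (switch O g) i × LateChain ord (switch O g) i
          ret₁ i i<d allB with allC , jᵢ , j* , ch , lt ← ret i i<d allB =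
              (λ j' → switch-old O g _ (b-set W≤U allB' j') (subst (λ e → b i j' ≢ tail e) (sym g≡) λ { refl → <-irrefl refl i<d }))
            , (jᵢ , j* , (λ k' → switch-old O g _ (a-set W≤U allB' (λ k → inside' _ (ch k)) k') (subst (λ e → a i jᵢ k' ≢ tail e) (sym g≡) λ ())) , lt)
            where
            open At richO opt i using (b-set; a-set)
            allB' : AllB F' i
            allB' j' = inside' _ (allC j')
            W≤U = ≤-reflexive (sym (eqs (suc (toℕ i)) i<d))

    count x st ctx [] [] = s≤s z≤n
    count {m = m} (done F≡B) st ctx (add {d = d} d<m fst ds) (allB ∷ allBs) =
      ⊥-elim (State.reset-b st d d<m (fromℕ< 0<ρ) (trans (sym (F≡B _)) (allB _)))
    count (skip {e = g} fo inner nimp) st ctx (add {d = d} d<m fst ds) (allB ∷ allBs) with is-b d g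
    ... | yes (j , g≡) = ⊥-elim (Count.Bit.no-skip fo inner st d<m allB j g≡ (Ctx-≤ ord ctx) ctx nimp)
    ... | no ne with Count.continue fo inner st d<m allB ctx
    ...   | inj₁ ctx' = count inner (Count.state' fo inner st d<m allB) ctx' (add d<m fst ds)
                          (Count.other-b fo inner st d<m allB (λ j eq → ne (j , eq)) fst allBs)
    ...   | inj₂ (no-skip , _) = ⊥-elim (no-skip nimp)
    count (take {e = g} fo inner imp rest) st ctx (add {d = d} d<m fst ds) (allB ∷ allBs) with is-b d g
    ... | yes (j , g≡) = both-steps
          (count inner state' ctx' (Descending-weaken ord (<⇒≤ d<m) ds) (other-d ds allBs))
          (count-pending rest (pending imp) ds allBs)
      where open Count fo inner st d<m allB
            open Bit j g≡ (Ctx-≤ ord ctx) ctx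
    ... | no ne with Count.continue fo inner st d<m allB ctx
    ...   | inj₁ ctx' = first-steps (count inner (Count.state' fo inner st d<m allB) ctx' (add d<m fst ds)
                          (Count.other-b fo inner st d<m allB (λ j eq → ne (j , eq)) fst allBs))
    ...   | inj₂ (_ , restarted) =
            last-steps (count rest (proj₁ (restarted imp)) (proj₂ (restarted imp)) (add d<m fst ds) (allB ∷ allBs))

    count-pending (done F≡C) pd ds allBs = ⊥-elim (Pending.no-a pd (proj₁ chain) (fromℕ< 0<s)
        (trans (sym (F≡C _)) (proj₂ chain _)))
      where chain = Pending.chain pd
            0<s : 0 < s
            0<s = n≢0⇒n>0 (≢-nonZero⁻¹ s)
    count-pending {d = d} (skip {e = g} fo inner nimp) pd ds allBs with is-b d g
    ... | yes (j , g≡) = ⊥-elim (CountPending.Bit.no-skip fo inner pd j g≡ nimp)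
    ... | no ne with CountPending.continue fo inner pd (λ j eq → ne (j , eq))
    ...   | inj₁ pd' = count-pending inner pd' ds (CountPending.below fo inner pd ≤-refl ds allBs)
    ...   | inj₂ (no-skip , _) = ⊥-elim (no-skip nimp)
    count-pending {d = d} (take {e = g} fo inner imp rest) pd ds allBs with is-b d g
    ... | yes (j , g≡) = last-steps (count-pending rest (CountPending.Bit.pending fo inner pd j g≡ imp) ds allBs)
    ... | no ne with CountPending.continue fo inner pd (λ j eq → ne (j , eq))
    ...   | inj₁ pd' = first-steps (count-pending inner pd' ds (CountPending.below fo inner pd ≤-refl ds allBs))
    ...   | inj₂ (_ , restarted) = last-steps (count rest (proj₁ (restarted imp)) (proj₂ (restarted imp)) ds allBs)

-- Monotone subsequences

AllPairs-lookup : ∀ {A : Set} {R : A → A → Set} {xs} → AllPairs R xs →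
                  ∀ {i j} → i Fin.< j → R (lookup xs i) (lookup xs j)
AllPairs-lookup (rs ∷ _) {zero} {suc j} _ = All.lookup rs (∈-lookup j)
AllPairs-lookup (_ ∷ rss) {suc i} {suc j} (s≤s i<j) = AllPairs-lookup rss i<j

module ErdősSzekeres {A : Set} {R S : A → A → Set} (R-trans : Transitive R) (S-trans : Transitive S) where

  private
    -- A point with its Seidenberg labels: an R-chain and an S-chain starting there.
    record Item : Set where
      constructor item
      field
        point   : A
        up down : List A
        up-R    : AllPairs R (point ∷ up)
        down-S  : AllPairs S (point ∷ down)

    open Item

    extend : ∀ {T : A → A → Set} → Transitive T → ∀ {x y ys} → T x y → AllPairs T (y ∷ ys) → AllPairs T (x ∷ y ∷ ys)
    extend tr Txy (Tys ∷ rest) = (Txy ∷ All.map (tr Txy) Tys) ∷ Tys ∷ rest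

    Smaller : ℕ → ℕ → Item → Set
    Smaller p q it = length (up it) < p ⊎ length (down it) < q

    weaken : ∀ {p q p' q'} → p ≤ p' → q ≤ q' → ∀ {it} → Smaller p q it → Smaller p' q' it
    weaken le le' = Sum.map (λ lt → <-≤-trans lt le) (λ lt → <-≤-trans lt le')

    -- A chain of x is rerouted through a later point only if it is not yet longer than that point's
    -- chain. This only lengthens it, so domination of the points already treated is preserved.
    label : ∀ x its → All (λ it → R x (point it) ⊎ S x (point it)) its →
            Σ Item λ new → point new ≡ x × All (Smaller (length (up new)) (length (down new))) its
    label x [] [] = item x [] [] ([] ∷ []) ([] ∷ []) , refl , []
    label x (it ∷ its) (c ∷ cs) with label x its cs
    ... | item .x U D pU pD , refl , sm with c
    ...   | inj₁ Rx with length U ≤? length (up it)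
    ...     | yes le = item x _ D (extend R-trans Rx (up-R it)) pD , refl
                     , inj₁ ≤-refl ∷ All.map (λ {it} → weaken (m≤n⇒m≤1+n le) ≤-refl {it}) sm
    ...     | no ¬le = item x U D pU pD , refl , inj₁ (≰⇒> ¬le) ∷ sm
    label x (it ∷ its) (c ∷ cs) | item .x U D pU pD , refl , sm | inj₂ Sx with length D ≤? length (down it)
    ...     | yes le = item x U _ pU (extend S-trans Sx (down-S it)) , refl
                     , inj₂ ≤-refl ∷ All.map (λ {it} → weaken ≤-refl (m≤n⇒m≤1+n le) {it}) sm
    ...     | no ¬le = item x U D pU pD , refl , inj₂ (≰⇒> ¬le) ∷ sm

    Dominates : Item → Item → Set
    Dominates new = Smaller (length (up new)) (length (down new))

    labels : ∀ xs → AllPairs (λ x y → R x y ⊎ S x y) xs →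
             Σ (List Item) λ its → length its ≡ length xs × AllPairs Dominates its
                                 × (∀ {P : A → Set} → All P xs → All (λ it → P (point it)) its)
    labels [] [] = [] , refl , [] , λ _ → []
    labels (x ∷ xs) (c ∷ cs) with labels xs cs
    ... | its , len , dom , pts with label x its (pts c)
    ...   | new , refl , sm = new ∷ its , cong suc len , sm ∷ dom , λ { (p ∷ ps) → p ∷ pts ps }

  -- Domination makes the pairs of labels distinct. Labels do not count the point itself, so if no
  -- chain reached length `suc m`, more than `m * m` points would share `m * m` pairs.
  monochromatic-chain : ∀ m xs → m * m ≤ length xs → AllPairs (λ x y → R x y ⊎ S x y) xs →
    ∃ λ ys → m ≤ length ys × (AllPairs R ys ⊎ AllPairs S ys)
  monochromatic-chain zero xs _ _ = [] , z≤n , inj₁ []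
  monochromatic-chain (suc m) xs m²≤ cs with labels xs cs
  ... | its , len , dom , _ with All.all? (λ it → (length (up it) <? m) ×-dec (length (down it) <? m)) its
  ...   | no ¬small with it , big ← satisfied (All.¬All⇒Any¬ (λ it → (length (up it) <? m) ×-dec (length (down it) <? m)) its ¬small)
                    with length (up it) <? m | length (down it) <? m
  ...     | no ¬p | _ = point it ∷ up it , s≤s (≮⇒≥ ¬p) , inj₁ (up-R it)
  ...     | yes _ | no ¬p = point it ∷ down it , s≤s (≮⇒≥ ¬p) , inj₂ (down-S it)
  ...     | yes p | yes p' = ⊥-elim (big (p , p'))
  monochromatic-chain (suc m) xs m²≤ cs | its , len , dom , _ | yes small =
    ⊥-elim (clash (Fin.pigeonhole m²<n λ i → combine (p i) (q i)))
    where
    m²<n : m * m < length its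
    m²<n = subst (m * m <_) (sym len) (<-≤-trans (*-mono-< (n<1+n m) (n<1+n m)) m²≤)
    small-at : ∀ i → _
    small-at i = All.lookup small (∈-lookup {xs = its} i)
    p q : Fin (length its) → Fin m
    p i = fromℕ< (proj₁ (small-at i))
    q i = fromℕ< (proj₂ (small-at i))
    same : ∀ {x y} {x<m : x < m} {y<m : y < m} → fromℕ< x<m ≡ fromℕ< y<m → x ≡ y
    same {x<m = x<m} {y<m} = Fin.fromℕ<-injective _ _ x<m y<m
    clash : (∃₂ λ i j → i Fin.< j × combine (p i) (q i) ≡ combine (p j) (q j)) → ⊥
    clash (i , j , i<j , eq) with Fin.combine-injective (p i) (q i) (p j) (q j) eq | AllPairs-lookup dom i<j
    ... | eq₁ , _ | inj₁ lt = <-irrefl (sym (same {x<m = proj₁ (small-at i)} {proj₁ (small-at j)} eq₁)) lt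
    ... | _ , eq₂ | inj₂ lt = <-irrefl (sym (same {x<m = proj₂ (small-at i)} {proj₂ (small-at j)} eq₂)) lt

-- Sums over all orderings of a list

module _ {A : Set} where

  insertions-↭ : ∀ (x : A) ys {zs} → zs ∈ insertions x ys → zs ↭ x ∷ ys
  insertions-↭ x [] (here refl) = ↭-refl
  insertions-↭ x (y ∷ ys) (here refl) = ↭-refl
  insertions-↭ x (y ∷ ys) (there p) with zs , zs∈ , refl ← ∈-map⁻ (y ∷_) p =
    ↭-trans (prep y (insertions-↭ x ys zs∈)) (swap y x ↭-refl)

  perms-↭ : ∀ (xs : List A) {zs} → zs ∈ perms xs → zs ↭ xs
  perms-↭ [] (here refl) = ↭-refl
  perms-↭ (x ∷ xs) p with ys , ys∈ , zs∈ ← find (∈-concatMap⁻ (insertions x) {xs = perms xs} p) =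
    ↭-trans (insertions-↭ x ys zs∈) (prep x (perms-↭ xs ys∈))

  -- Summing by recursion on the insertion point turns the exchange of two insertions into an
  -- identity between numbers, where the lists of results would agree only up to order.
  ∑ins : A → List A → (List A → ℕ) → ℕ
  ∑ins x []       F = F [ x ]
  ∑ins x (y ∷ ys) F = F (x ∷ y ∷ ys) + ∑ins x ys (λ zs → F (y ∷ zs))

  ∑perms : List A → (List A → ℕ) → ℕ
  ∑perms []       F = F []
  ∑perms (x ∷ xs) F = ∑perms xs λ ys → ∑ins x ys F

  ∑ins-sum : ∀ x ys F → sum (map F (insertions x ys)) ≡ ∑ins x ys F
  ∑ins-sum x [] F = +-identityʳ _
  ∑ins-sum x (y ∷ ys) F = cong (F (x ∷ y ∷ ys) +_)
    (trans (cong sum (sym (map-∘ (insertions x ys)))) (∑ins-sum x ys (λ zs → F (y ∷ zs))))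

  ∑perms-sum : ∀ xs F → sum (map F (perms xs)) ≡ ∑perms xs F
  ∑perms-sum [] F = +-identityʳ _
  ∑perms-sum (x ∷ xs) F = trans (flatten (perms xs)) (∑perms-sum xs (λ ys → ∑ins x ys F))
    where
    flatten : ∀ yss → sum (map F (concatMap (insertions x) yss)) ≡ sum (map (λ ys → ∑ins x ys F) yss)
    flatten [] = refl
    flatten (ys ∷ yss) = trans (cong sum (map-++ F (insertions x ys) _))
      (trans (sum-++ (map F (insertions x ys)) _) (cong₂ _+_ (∑ins-sum x ys F) (flatten yss)))

  ∑ins-cong : ∀ x ys {F G} → (∀ zs → F zs ≡ G zs) → ∑ins x ys F ≡ ∑ins x ys G
  ∑ins-cong x [] eq = eq _
  ∑ins-cong x (y ∷ ys) eq = cong₂ _+_ (eq _) (∑ins-cong x ys λ zs → eq (y ∷ zs))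

  ∑perms-cong : ∀ xs {F G} → (∀ zs → F zs ≡ G zs) → ∑perms xs F ≡ ∑perms xs G
  ∑perms-cong [] eq = eq _
  ∑perms-cong (x ∷ xs) eq = ∑perms-cong xs λ ys → ∑ins-cong x ys eq

  private
    interchange : ∀ a b c d → (a + b) + (c + d) ≡ (a + c) + (b + d)
    interchange = solve 4 (λ a b c d → (a :+ b) :+ (c :+ d) := (a :+ c) :+ (b :+ d)) refl
      where open +-*-Solver

  ∑ins-+ : ∀ x ys F G → ∑ins x ys (λ zs → F zs + G zs) ≡ ∑ins x ys F + ∑ins x ys G
  ∑ins-+ x [] F G = refl
  ∑ins-+ x (y ∷ ys) F G = trans (cong (_ +_) (∑ins-+ x ys _ _)) (interchange (F (x ∷ y ∷ ys)) _ _ _)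

  ∑ins-comm : ∀ x y zs F → ∑ins y zs (λ ws → ∑ins x ws F) ≡ ∑ins x zs (λ ws → ∑ins y ws F)
  ∑ins-comm x y [] F = +-comm (F (x ∷ y ∷ [])) (F (y ∷ x ∷ []))
  ∑ins-comm x y (z ∷ zs) F = trans
    (cong ((F (x ∷ y ∷ z ∷ zs) + (F (y ∷ x ∷ z ∷ zs) + ∑ins x zs (λ ws → F (y ∷ z ∷ ws)))) +_)
      (trans (∑ins-+ y zs (λ ws → F (x ∷ z ∷ ws)) (λ ws → ∑ins x ws (λ vs → F (z ∷ vs))))
             (cong (∑ins y zs (λ ws → F (x ∷ z ∷ ws)) +_) (∑ins-comm x y zs (λ vs → F (z ∷ vs))))))
    (trans (swap-terms (F (x ∷ y ∷ z ∷ zs)) (F (y ∷ x ∷ z ∷ zs)) (∑ins x zs (λ ws → F (y ∷ z ∷ ws)))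
             (∑ins y zs (λ ws → F (x ∷ z ∷ ws))) (∑ins x zs (λ ws → ∑ins y ws (λ vs → F (z ∷ vs)))))
      (cong ((F (y ∷ x ∷ z ∷ zs) + (F (x ∷ y ∷ z ∷ zs) + ∑ins y zs (λ ws → F (x ∷ z ∷ ws)))) +_)
        (sym (∑ins-+ x zs (λ ws → F (y ∷ z ∷ ws)) (λ ws → ∑ins y ws (λ vs → F (z ∷ vs)))))))
    where
    swap-terms : ∀ a b c d e → (a + (b + c)) + (d + e) ≡ (b + (a + d)) + (c + e)
    swap-terms = solve 5 (λ a b c d e → (a :+ (b :+ c)) :+ (d :+ e) := (b :+ (a :+ d)) :+ (c :+ e)) refl
      where open +-*-Solver

  ∑perms-↭ : ∀ {xs ys} → xs ↭ ys → ∀ F → ∑perms xs F ≡ ∑perms ys F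
  ∑perms-↭ ↭.refl F = refl
  ∑perms-↭ (prep x p) F = ∑perms-↭ p _
  ∑perms-↭ {_ ∷ _ ∷ xs} (swap x y p) F = trans (∑perms-cong xs λ zs → ∑ins-comm x y zs F) (∑perms-↭ p _)
  ∑perms-↭ (↭.trans p q) F = trans (∑perms-↭ p F) (∑perms-↭ q F)

  ∑ins-map : ∀ (f : A → A) x ys F → ∑ins x ys (F ∘ map f) ≡ ∑ins (f x) (map f ys) F
  ∑ins-map f x [] F = refl
  ∑ins-map f x (y ∷ ys) F = cong (F (f x ∷ f y ∷ map f ys) +_) (∑ins-map f x ys (λ zs → F (f y ∷ zs)))

  ∑perms-map : ∀ (f : A → A) xs F → ∑perms xs (F ∘ map f) ≡ ∑perms (map f xs) F
  ∑perms-map f [] F = refl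
  ∑perms-map f (x ∷ xs) F = trans (∑perms-cong xs λ ys → ∑ins-map f x ys F) (∑perms-map f xs _)

  -- The sum depends only on the multiset being ordered. Probabilistically: a relabelling that
  -- permutes the edges preserves the uniform distribution of orderings.
  sum-perms-map : ∀ (f : A → A) xs → map f xs ↭ xs → ∀ F → sum (map (F ∘ map f) (perms xs)) ≡ sum (map F (perms xs))
  sum-perms-map f xs p F = trans (∑perms-sum xs (F ∘ map f))
    (trans (∑perms-map f xs F) (trans (∑perms-↭ p F) (sym (∑perms-sum xs F))))

-- Edge involutions permute the list of all edges

concatMap-unique : ∀ {A B : Set} (f : A → List B) {xs} → (∀ {x x' y} → y ∈ f x → y ∈ f x' → x ≡ x') →
                   (∀ x → Unique (f x)) → Unique xs → Unique (concatMap f xs)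
concatMap-unique f {xs} disj uniq uxs = Unique.concat⁺ (All.map⁺ (All.universal uniq xs))
  (AllPairs.map⁺ (AllPairs.map (λ x≢x' {_} (p , p') → x≢x' (disj p p')) uxs))

module Symmetry (n r s t : ℕ) .{{r≢0 : NonZero r}} .{{s≢0 : NonZero s}} where

  open GraphFacts n r s t {{r≢0}} {{s≢0}} public

  private
    -- Kinds are numbered in the order of `blocksAt`, so disjointness of all pairs of blocks follows
    -- from one induction along the list.
    tag : Ed → ℕ
    tag (a1 _ _ _)   = 0
    tag (a0 _ _ _ _) = 1
    tag (b1 _ _)     = 2
    tag (b0 _ _ _)   = 3
    tag (u1 _ _)     = 4
    tag (u0 _ _)     = 5
    tag (wj _ _ _)   = 6
    tag (w0 _ _)     = 7

    Is : Fin n → ℕ → Ed → Set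
    Is i c e = level e ≡ i × tag e ≡ c

    all-map : ∀ {P : Ed → Set} {m} (f : Fin m → Ed) → (∀ k → P (f k)) → All P (map f (allFin m))
    all-map f h = All.map⁺ (All.universal h (allFin _))

    all-concatMap : ∀ {P : Ed → Set} {m} (f : Fin m → List Ed) → (∀ k → All P (f k)) → All P (concatMap f (allFin m))
    all-concatMap f h = All.concat⁺ (All.map⁺ (All.universal h (allFin _)))

    data Tagged (i : Fin n) : ℕ → List (List Ed) → Set where
      []  : ∀ {c} → Tagged i c []
      _∷_ : ∀ {c es ess} → All (Is i c) es → Tagged i (suc c) ess → Tagged i c (es ∷ ess)

    blocks-tagged : ∀ i → Tagged i 0 (blocksAt i)
    blocks-tagged i =
        all-concatMap (λ j → map (a1 i j) (allFin s)) (λ j → all-map (a1 i j) λ _ → refl , refl)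
      ∷ all-concatMap (λ j → concatMap (λ k → map (a0 i j k) (allFin t)) (allFin s))
          (λ j → all-concatMap (λ k → map (a0 i j k) (allFin t)) λ k → all-map (a0 i j k) λ _ → refl , refl)
      ∷ all-map (b1 i) (λ _ → refl , refl)
      ∷ all-concatMap (λ j → map (b0 i j) (allFin t)) (λ j → all-map (b0 i j) λ _ → refl , refl)
      ∷ all-map (u1 i) (λ _ → refl , refl)
      ∷ all-map (u0 i) (λ _ → refl , refl)
      ∷ all-concatMap (λ j → map (wj i j) (allFin t)) (λ j → all-map (wj i j) λ _ → refl , refl)
      ∷ all-map (w0 i) (λ _ → refl , refl)
      ∷ []

    tagged-above : ∀ {i c ess} → Tagged i c ess → All (All (λ e → c ≤ tag e)) ess
    tagged-above [] = []
    tagged-above (es ∷ ess) = All.map (λ (_ , eq) → ≤-reflexive (sym eq)) es ∷ All.map (All.map <⇒≤) (tagged-above ess)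

    tagged-disjoint : ∀ {i c ess} → Tagged i c ess → AllPairs Disjoint ess
    tagged-disjoint [] = []
    tagged-disjoint (es ∷ ess) =
      All.map (λ above {_} (p , p') → <-irrefl (sym (proj₂ (All.lookup es p))) (All.lookup above p')) (tagged-above ess)
      ∷ tagged-disjoint ess

    tagged-level : ∀ {i c ess} → Tagged i c ess → All (λ e → level e ≡ i) (concat ess)
    tagged-level [] = []
    tagged-level (es ∷ ess) = All.++⁺ (All.map proj₁ es) (tagged-level ess)

    unique-map : ∀ {m} (f : Fin m → Ed) → (∀ {k k'} → f k ≡ f k' → k ≡ k') → Unique (map f (allFin m))
    unique-map f inj = Unique.map⁺ inj (Unique.allFin⁺ _)

    unique-maps : ∀ {m m'} (f : Fin m → Fin m' → Ed) → (∀ {j j' k k'} → f j k ≡ f j' k' → j ≡ j' × k ≡ k') →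
                  Unique (concatMap (λ j → map (f j) (allFin m')) (allFin m))
    unique-maps f inj = concatMap-unique (λ j → map (f j) (allFin _)) disj
      (λ j → unique-map (f j) (proj₂ ∘ inj)) (Unique.allFin⁺ _)
      where
      disj : ∀ {x x' y} → y ∈ map (f x) (allFin _) → y ∈ map (f x') (allFin _) → x ≡ x'
      disj p p' with k , _ , eq ← ∈-map⁻ _ p | k' , _ , eq' ← ∈-map⁻ _ p' = proj₁ (inj (trans (sym eq) eq'))

    blocks-unique : ∀ i → All Unique (blocksAt i)
    blocks-unique i =
        unique-maps (a1 i) (λ { refl → refl , refl })
      ∷ concatMap-unique (λ j → concatMap (λ k → map (a0 i j k) (allFin t)) (allFin s))
          (λ p p' → Fin.toℕ-injective (trans (sym (row p)) (row p'))) (λ j → unique-maps (a0 i j) (λ { refl → refl , refl })) (Unique.allFin⁺ r)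
      ∷ unique-map (b1 i) (λ { refl → refl })
      ∷ unique-maps (b0 i) (λ { refl → refl , refl })
      ∷ unique-map (u1 i) (λ { refl → refl })
      ∷ unique-map (u0 i) (λ { refl → refl })
      ∷ unique-maps (wj i) (λ { refl → refl , refl })
      ∷ unique-map (w0 i) (λ { refl → refl })
      ∷ []
      where
      row-of : Ed → ℕ
      row-of (a0 _ j _ _) = toℕ j
      row-of _ = 0
      row : ∀ {j e} → e ∈ concatMap (λ k → map (a0 i j k) (allFin t)) (allFin s) → row-of e ≡ toℕ j
      row {j} = All.lookup (all-concatMap {P = λ e → row-of e ≡ toℕ j} (λ k → map (a0 i j k) (allFin t)) λ k → all-map (a0 i j k) λ _ → refl)

  allEdges-unique : Unique allEdges
  allEdges-unique = subst Unique (sym allEdges-blocks) (concatMap-unique (concat ∘ blocksAt)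
    (λ p p' → trans (sym (All.lookup (tagged-level (blocks-tagged _)) p)) (All.lookup (tagged-level (blocks-tagged _)) p'))
    (λ i → Unique.concat⁺ (blocks-unique i) (tagged-disjoint (blocks-tagged i))) (Unique.allFin⁺ n))

  involution-↭ : (f : Ed → Ed) → (∀ e → f (f e) ≡ e) → map f allEdges ↭ allEdges
  involution-↭ f inv = ∼bag⇒↭ (unique∧set⇒bag
    (Unique.map⁺ (λ {x} {y} eq → trans (sym (inv x)) (trans (cong f eq) (inv y))) allEdges-unique) allEdges-unique
    λ {e} → mk⇔ (λ _ → allEdges-complete e) (λ _ → subst (_∈ map f allEdges) (inv e) (∈-map⁺ f (allEdges-complete (f e)))))

-- Rare events under a random ordering

sum-map-+ : ∀ {A : Set} (F G : A → ℕ) xs → sum (map (λ x → F x + G x) xs) ≡ sum (map F xs) + sum (map G xs)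
sum-map-+ F G [] = refl
sum-map-+ F G (x ∷ xs) = trans (cong ((F x + G x) +_) (sum-map-+ F G xs))
  (solve 4 (λ a b c d → (a :+ b) :+ (c :+ d) := (a :+ c) :+ (b :+ d)) refl (F x) (G x) _ _)
  where open +-*-Solver

sum-map-const : ∀ {A : Set} c (xs : List A) → sum (map (λ _ → c) xs) ≡ length xs * c
sum-map-const c [] = refl
sum-map-const c (x ∷ xs) = cong (c +_) (sum-map-const c xs)

length-concatMap : ∀ {A B : Set} (f : A → List B) {c} → (∀ x → length (f x) ≡ c) → ∀ xs → length (concatMap f xs) ≡ length xs * c
length-concatMap f h [] = refl
length-concatMap f h (x ∷ xs) = trans (length-++ (f x)) (cong₂ _+_ (h x) (length-concatMap f h xs))

length-allFin : ∀ m → length (allFin m) ≡ m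
length-allFin m = length-tabulate (λ x → x)

minF : ∀ {m} → (Fin (suc m) → ℕ) → ℕ
minF {zero}  g = g zero
minF {suc m} g = g zero ⊓ minF (g ∘ suc)

minF-≤ : ∀ {m} (g : Fin (suc m) → ℕ) k → minF g ≤ g k
minF-≤ {zero} g zero = ≤-refl
minF-≤ {suc m} g zero = m⊓n≤m _ _
minF-≤ {suc m} g (suc k) = ≤-trans (m⊓n≤n (g zero) _) (minF-≤ (g ∘ suc) k)

minF-attained : ∀ {m} (g : Fin (suc m) → ℕ) → ∃ λ k → g k ≡ minF g
minF-attained {zero} g = zero , refl
minF-attained {suc m} g with ⊓-sel (g zero) (minF (g ∘ suc)) | minF-attained (g ∘ suc)
... | inj₁ eq | _ = zero , sym eq
... | inj₂ eq | k , eq' = suc k , trans eq' (sym eq)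

minF-cong : ∀ {m} {g h : Fin (suc m) → ℕ} → (∀ k → g k ≡ h k) → minF g ≡ minF h
minF-cong {zero} eq = eq zero
minF-cong {suc m} eq = cong₂ _⊓_ (eq zero) (minF-cong (eq ∘ suc))

arg-max : ∀ {m} (g : Fin (suc m) → ℕ) → ∃ λ l → ∀ k → g k ≤ g l
arg-max {zero} g = zero , λ { zero → ≤-refl }
arg-max {suc m} g with arg-max (g ∘ suc)
... | l , max with ≤-total (g zero) (g (suc l))
...   | inj₁ le = suc l , λ { zero → le ; (suc k) → max k }
...   | inj₂ le = zero , λ { zero → ≤-refl ; (suc k) → ≤-trans (max k) le }

ind : Bool → ℕ
ind b = if b then 1 else 0

<ᵇ-true : ∀ {x y} → (x <ᵇ y) ≡ true → x < y
<ᵇ-true {x} {y} eq = <ᵇ⇒< x y (subst T (sym eq) tt)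

<ᵇ-false : ∀ {x y} → (x <ᵇ y) ≡ false → y ≤ x
<ᵇ-false {x} {y} eq = ≮⇒≥ λ lt → subst T eq (<⇒<ᵇ lt)

module RareEvents (n f' : ℕ) where

  f : ℕ
  f = suc f'

  open SwitchCount n f f f public
  open Symmetry n f f f using (involution-↭)

  #_ : (List Ed → ℕ) → ℕ
  # F = sum (map F orderings)

  #-relabel : (τ : Ed → Ed) → (∀ e → τ (τ e) ≡ e) → ∀ F → # (F ∘ map τ) ≡ # F
  #-relabel τ inv = sum-perms-map τ allEdges (involution-↭ τ inv)

  pos-relabel : (τ : Ed → Ed) → (∀ e → τ (τ e) ≡ e) → ∀ ord e → pos (map τ ord) e ≡ pos ord (τ e)
  pos-relabel τ inv [] e = refl
  pos-relabel τ inv (x ∷ xs) e with eqE x (τ e) in p | eqE (τ x) e in q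
  ... | true  | true  = refl
  ... | false | false = cong suc (pos-relabel τ inv xs e)
  ... | true  | false with refl ← eqE-sound x (τ e) p rewrite inv e with () ← trans (sym q) (eqE-refl e)
  ... | false | true  with refl ← eqE-sound (τ x) e q rewrite inv x with () ← trans (sym p) (eqE-refl x)

  all-holds : ∀ {m} → (Fin m → List Ed → Bool) → List Ed → Bool
  all-holds {zero}  E σ = true
  all-holds {suc m} E σ = E zero σ ∧ all-holds (E ∘ suc) σ

  all-fails : ∀ {m} (E : Fin m → List Ed → Bool) σ → all-holds E σ ≡ false → ∃ λ k → E k σ ≡ false
  all-fails {suc m} E σ eq with E zero σ in p
  ... | false = zero , p
  ... | true with k , q ← all-fails (E ∘ suc) σ eq = suc k , q

  all-holds-cong : ∀ {m} (E : Fin m → List Ed → Bool) σ σ' → (∀ k → E k σ ≡ E k σ') → all-holds E σ ≡ all-holds E σ'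
  all-holds-cong {zero} E σ σ' eq = refl
  all-holds-cong {suc m} E σ σ' eq = cong₂ _∧_ (eq zero) (all-holds-cong (E ∘ suc) σ σ' (eq ∘ suc))

  -- Each involution τ k flips the k-th comparison and preserves the others,
  -- so imposing one more comparison at least halves the number of orderings.
  halving : ∀ {m} (X Y : Fin m → List Ed → ℕ) (τ : Fin m → Ed → Ed) → (∀ k e → τ k (τ k e) ≡ e) →
            (∀ k σ → X k (map (τ k) σ) ≡ Y k σ) → (∀ k σ → Y k (map (τ k) σ) ≡ X k σ) →
            (∀ k k' σ → k ≢ k' → X k' (map (τ k) σ) ≡ X k' σ) → (∀ k k' σ → k ≢ k' → Y k' (map (τ k) σ) ≡ Y k' σ) →
            2 ^ m * # (λ σ → ind (all-holds (λ k σ → X k σ <ᵇ Y k σ) σ)) ≤ length orderings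
  halving {zero} X Y τ inv XY YX X≡ Y≡ =
    ≤-reflexive (trans (+-identityʳ _) (trans (sum-map-const 1 orderings) (*-identityʳ _)))
  halving {suc m} X Y τ inv XY YX X≡ Y≡ = begin
    2 * 2 ^ m * # G               ≡⟨ solve 2 (λ p x → con 2 :* p :* x := p :* (x :+ x)) refl (2 ^ m) (# G) ⟩
    2 ^ m * (# G + # G)           ≡⟨ cong (λ x → 2 ^ m * (# G + x)) (sym (#-relabel (τ zero) (inv zero) G)) ⟩
    2 ^ m * (# G + # (G ∘ map (τ zero)))   ≡⟨ cong (2 ^ m *_) (sym (sum-map-+ G (G ∘ map (τ zero)) orderings)) ⟩
    2 ^ m * # (λ σ → G σ + G (map (τ zero) σ))  ≤⟨ *-monoʳ-≤ (2 ^ m) (sum-map-≤ orderings pointwise) ⟩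
    2 ^ m * # (ind ∘ rest)        ≤⟨ halving (X ∘ suc) (Y ∘ suc) (τ ∘ suc) (inv ∘ suc) (XY ∘ suc) (YX ∘ suc)
                                       (λ k k' σ ne → X≡ (suc k) (suc k') σ (ne ∘ Fin.suc-injective))
                                       (λ k k' σ ne → Y≡ (suc k) (suc k') σ (ne ∘ Fin.suc-injective)) ⟩
    length orderings              ∎
    where
    open ≤-Reasoning
    open +-*-Solver
    rest : List Ed → Bool
    rest = all-holds (λ k σ → X (suc k) σ <ᵇ Y (suc k) σ)
    G : List Ed → ℕ
    G = λ σ → ind ((X zero σ <ᵇ Y zero σ) ∧ rest σ)
    rest≡ : ∀ σ → rest (map (τ zero) σ) ≡ rest σ
    rest≡ σ = all-holds-cong _ (map (τ zero) σ) σ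
      λ k → cong₂ _<ᵇ_ (X≡ zero (suc k) σ λ ()) (Y≡ zero (suc k) σ λ ())
    pointwise : ∀ σ → G σ + G (map (τ zero) σ) ≤ ind (rest σ)
    pointwise σ rewrite rest≡ σ | XY zero σ | YX zero σ with rest σ | X zero σ <ᵇ Y zero σ in p | Y zero σ <ᵇ X zero σ in q
    ... | true  | true  | true  = ⊥-elim (<-asym (<ᵇ-true {X zero σ} p) (<ᵇ-true {Y zero σ} q))
    ... | true  | true  | false = ≤-refl
    ... | true  | false | true  = ≤-refl
    ... | true  | false | false = z≤n
    ... | false | true  | true  = z≤n
    ... | false | true  | false = z≤n
    ... | false | false | true  = z≤n
    ... | false | false | false = z≤n

  -- `rare` is the bound 2^-f on the probability, cleared of division.
  record Event : Set where
    field
      holds : List Ed → Bool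
      rare  : 2 ^ f * # (ind ∘ holds) ≤ length orderings

  record Copies : Set where
    field
      copy     : Fin f → Ed
      distinct : ∀ {k k'} → copy k ≡ copy k' → k ≡ k'
      not-a1   : ∀ {k i j k'} → copy k ≢ a1 i j k'

  transpose : Ed → Ed → Ed → Ed
  transpose x y e with e ≟E x
  ... | yes _ = y
  ... | no _ with e ≟E y
  ...   | yes _ = x
  ...   | no _ = e

  transpose-left : ∀ x y → transpose x y x ≡ y
  transpose-left x y with x ≟E x
  ... | yes _ = refl
  ... | no ne = ⊥-elim (ne refl)

  transpose-right : ∀ x y → transpose x y y ≡ x
  transpose-right x y with y ≟E x
  ... | yes eq = eq
  ... | no _ with y ≟E y
  ...   | yes _ = refl
  ...   | no ne = ⊥-elim (ne refl)

  transpose-other : ∀ x y e → e ≢ x → e ≢ y → transpose x y e ≡ e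
  transpose-other x y e ne ne' with e ≟E x
  ... | yes eq = ⊥-elim (ne eq)
  ... | no _ with e ≟E y
  ...   | yes eq = ⊥-elim (ne' eq)
  ...   | no _ = refl

  transpose-involutive : ∀ x y e → transpose x y (transpose x y e) ≡ e
  transpose-involutive x y e with e ≟E x
  ... | yes refl = transpose-right e y
  ... | no ne with e ≟E y
  ...   | yes refl = transpose-left x e
  ...   | no ne' = transpose-other x y e ne ne'

  -- Comparing only the k-th copy with the k-th edge of the chain enlarges the event that all copies
  -- precede the whole chain, but makes the comparisons independent.
  module _ (i : Fin n) (j : Fin f) (γ : Copies) where
    open Copies γ

    private
      τ : Fin f → Ed → Ed
      τ k = transpose (copy k) (a1 i j k)

      X Y : Fin f → List Ed → ℕ
      X k σ = pos σ (copy k)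
      Y k σ = pos σ (a1 i j k)

      moved : ∀ k σ e {e'} → τ k e ≡ e' → pos (map (τ k) σ) e ≡ pos σ e'
      moved k σ e eq = trans (pos-relabel (τ k) (transpose-involutive (copy k) (a1 i j k)) σ e) (cong (pos σ) eq)

    copies-event : Event
    copies-event = record
      { holds = all-holds (λ k σ → X k σ <ᵇ Y k σ)
      ; rare  = halving X Y τ (λ k → transpose-involutive (copy k) (a1 i j k))
          (λ k σ → moved k σ (copy k) (transpose-left (copy k) (a1 i j k)))
          (λ k σ → moved k σ (a1 i j k) (transpose-right (copy k) (a1 i j k)))
          (λ k k' σ ne → moved k σ (copy k') (transpose-other _ _ _ (λ eq → ne (distinct (sym eq))) not-a1))
          (λ k k' σ ne → moved k σ (a1 i j k') (transpose-other _ _ _ (λ eq → not-a1 (sym eq)) λ { refl → ne refl })) }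

    copies-late : ∀ σ → Event.holds copies-event σ ≡ false → ∃ λ k → pos σ (a1 i j k) ≤ pos σ (copy k)
    copies-late σ eq with k , p ← all-fails (λ k σ → X k σ <ᵇ Y k σ) σ eq = k , <ᵇ-false {pos σ (copy k)} p

  -- Cutting the b-edges of a level into one block for each chain makes the comparisons of first edges
  -- independent; together they contain the event that every chain starts before all b-edges.
  module _ (i : Fin n) where

    private
      block : Fin f → Fin f → Ed
      block j k = b1 i (combine j k)

      -- Exchanges the j-th chain with the j-th block, edge by edge. This swaps the two minima
      -- compared at j and fixes those of every other index; it works because a block has as many
      -- edges as a chain.
      τ : Fin f → Ed → Ed
      τ j (a1 i' j' k) with i' Fin.≟ i | j' Fin.≟ j
      ... | yes _ | yes _ = block j k
      ... | _     | _     = a1 i' j' k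
      τ j (b1 i' m) with i' Fin.≟ i | proj₁ (remQuot {f} f m) Fin.≟ j
      ... | yes _ | yes _ = a1 i j (proj₂ (remQuot {f} f m))
      ... | _     | _     = b1 i' m
      τ j e = e

      τ-chain : ∀ j k → τ j (a1 i j k) ≡ block j k
      τ-chain j k with i Fin.≟ i | j Fin.≟ j
      ... | yes _ | yes _ = refl
      ... | no ne | _     = ⊥-elim (ne refl)
      ... | yes _ | no ne = ⊥-elim (ne refl)

      τ-chain-other : ∀ j {j'} k → j ≢ j' → τ j (a1 i j' k) ≡ a1 i j' k
      τ-chain-other j {j'} k ne with i Fin.≟ i | j' Fin.≟ j
      ... | yes _ | yes eq = ⊥-elim (ne (sym eq))
      ... | yes _ | no _   = refl
      ... | no _  | _      = refl

      τ-block : ∀ j k → τ j (block j k) ≡ a1 i j k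
      τ-block j k with i Fin.≟ i | proj₁ (remQuot {f} f (combine j k)) Fin.≟ j
      ... | yes _ | yes _ = cong (λ (_ , k) → a1 i j k) (Fin.remQuot-combine j k)
      ... | no ne | _     = ⊥-elim (ne refl)
      ... | yes _ | no ne = ⊥-elim (ne (cong proj₁ (Fin.remQuot-combine j k)))

      τ-block-other : ∀ j {j'} k → j ≢ j' → τ j (block j' k) ≡ block j' k
      τ-block-other j {j'} k ne with i Fin.≟ i | proj₁ (remQuot {f} f (combine j' k)) Fin.≟ j
      ... | yes _ | yes eq = ⊥-elim (ne (trans (sym eq) (cong proj₁ (Fin.remQuot-combine j' k))))
      ... | yes _ | no _   = refl
      ... | no _  | _      = refl

      τ-involutive : ∀ j e → τ j (τ j e) ≡ e
      τ-involutive j (a1 i' j' k) with i' Fin.≟ i in p | j' Fin.≟ j in q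
      ... | yes refl | yes refl = τ-block j k
      ... | no _     | _ rewrite p = refl
      ... | yes _    | no _ rewrite p | q = refl
      τ-involutive j (b1 i' m) with i' Fin.≟ i in p | proj₁ (remQuot {f} f m) Fin.≟ j in q
      ... | yes refl | yes refl = trans (τ-chain j (proj₂ (remQuot {f} f m))) (cong (b1 i') (Fin.combine-remQuot {f} f m))
      ... | no _     | _ rewrite p = refl
      ... | yes _    | no _ rewrite p | q = refl
      τ-involutive j (a0 _ _ _ _) = refl
      τ-involutive j (b0 _ _ _) = refl
      τ-involutive j (u1 _ _) = refl
      τ-involutive j (u0 _ _) = refl
      τ-involutive j (wj _ _ _) = refl
      τ-involutive j (w0 _ _) = refl

      X Y : Fin f → List Ed → ℕ
      X j σ = minF λ k → pos σ (a1 i j k)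
      Y j σ = minF λ k → pos σ (block j k)

      moved : ∀ j σ (es es' : Fin f → Ed) → (∀ k → τ j (es k) ≡ es' k) →
              minF (λ k → pos (map (τ j) σ) (es k)) ≡ minF (λ k → pos σ (es' k))
      moved j σ es es' eq = minF-cong λ k → trans (pos-relabel (τ j) (τ-involutive j) σ (es k)) (cong (pos σ) (eq k))

    chains-event : Event
    chains-event = record
      { holds = all-holds (λ j σ → X j σ <ᵇ Y j σ)
      ; rare  = halving X Y τ τ-involutive
          (λ j σ → moved j σ (a1 i j) (block j) (τ-chain j))
          (λ j σ → moved j σ (block j) (a1 i j) (τ-block j))
          (λ j j' σ ne → moved j σ (a1 i j') (a1 i j') λ k → τ-chain-other j k ne)
          (λ j j' σ ne → moved j σ (block j') (block j') λ k → τ-block-other j k ne) }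

    chains-late : ∀ σ → Event.holds chains-event σ ≡ false → ∃₂ λ j j* → ∀ k → pos σ (b1 i j*) ≤ pos σ (a1 i j k)
    chains-late σ eq with j , p ← all-fails (λ j σ → X j σ <ᵇ Y j σ) σ eq with k* , q ← minF-attained (λ k → pos σ (block j k)) =
      j , combine j k* , λ k → ≤-trans (≤-reflexive q) (≤-trans (<ᵇ-false {X j σ} p) (minF-≤ (λ k → pos σ (a1 i j k)) k))

-- Averaging over orderings and their mirror images

module Average (n f' : ℕ) where

  open RareEvents n f' public

  length-map-allFin : ∀ {A : Set} {m} (g : Fin m → A) → length (map g (allFin m)) ≡ m
  length-map-allFin {m = m} g = trans (length-map g (allFin m)) (length-allFin m)

  copies-u0 copies-w0 copies-u1 : Fin n → Copies
  copies-u0 i = record { copy = u0 i ; distinct = λ { refl → refl } ; not-a1 = λ () }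
  copies-w0 i = record { copy = w0 i ; distinct = λ { refl → refl } ; not-a1 = λ () }
  copies-u1 i = record { copy = u1 i ; distinct = λ { refl → refl } ; not-a1 = λ () }

  copies-wj : Fin n → Fin f → Copies
  copies-wj i j = record { copy = wj i j ; distinct = λ { refl → refl } ; not-a1 = λ () }

  copies-b0 : Fin n → Fin (f * f) → Copies
  copies-b0 i j = record { copy = b0 i j ; distinct = λ { refl → refl } ; not-a1 = λ () }

  copies-a0 : Fin n → Fin f → Fin f → Copies
  copies-a0 i j k = record { copy = a0 i j k ; distinct = λ { refl → refl } ; not-a1 = λ () }

  copiesAt : Fin n → List Copies
  copiesAt i = copies-u0 i ∷ copies-w0 i ∷ copies-u1 i ∷ map (copies-wj i) (allFin f)
    ++ map (copies-b0 i) (allFin (f * f)) ++ concatMap (λ j → map (copies-a0 i j) (allFin f)) (allFin f)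

  all-copies : List Copies
  all-copies = concatMap copiesAt (allFin n)

  eventsAt : Fin n → List Event
  eventsAt i = chains-event i ∷ concatMap (λ j → map (copies-event i j) all-copies) (allFin f)

  events : List Event
  events = concatMap eventsAt (allFin n)

  #copies : ℕ
  #copies = n * (3 + (f + (f * f + f * f)))

  length-copies : length all-copies ≡ #copies
  length-copies = trans (length-concatMap copiesAt per-level (allFin n)) (cong (_* (3 + (f + (f * f + f * f)))) (length-allFin n))
    where
    per-level : ∀ i → length (copiesAt i) ≡ 3 + (f + (f * f + f * f))
    per-level i = cong (3 +_) (trans (length-++ (map (copies-wj i) (allFin f)))
      (cong₂ _+_ (length-map-allFin (copies-wj i)) (trans (length-++ (map (copies-b0 i) (allFin (f * f))))
        (cong₂ _+_ (length-map-allFin (copies-b0 i))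
          (trans (length-concatMap (λ j → map (copies-a0 i j) (allFin f)) (λ j → length-map-allFin (copies-a0 i j)) (allFin f))
                 (cong (_* f) (length-allFin f)))))))

  length-events : length events ≡ n * (1 + f * #copies)
  length-events = trans (length-concatMap eventsAt
      (λ i → cong suc (trans (length-concatMap (λ j → map (copies-event i j) all-copies)
        (λ j → trans (length-map (copies-event i j) all-copies) length-copies) (allFin f)) (cong (_* #copies) (length-allFin f))))
      (allFin n)) (cong (_* (1 + f * #copies)) (length-allFin n))

  failures : List Event → List Ed → ℕ
  failures evs σ = sum (map (λ ev → ind (Event.holds ev σ)) evs)

  failures-rare : ∀ evs → 2 ^ f * # failures evs ≤ length evs * length orderings
  failures-rare [] = ≤-reflexive (trans (cong (2 ^ f *_) (trans (sum-map-const 0 orderings) (*-zeroʳ (length orderings)))) (*-zeroʳ (2 ^ f)))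
  failures-rare (ev ∷ evs) = begin
    2 ^ f * # failures (ev ∷ evs)                            ≡⟨ cong (2 ^ f *_) (sum-map-+ (ind ∘ Event.holds ev) (failures evs) orderings) ⟩
    2 ^ f * (# (ind ∘ Event.holds ev) + # failures evs)      ≡⟨ *-distribˡ-+ (2 ^ f) (# (ind ∘ Event.holds ev)) (# failures evs) ⟩
    2 ^ f * # (ind ∘ Event.holds ev) + 2 ^ f * # failures evs ≤⟨ +-mono-≤ (Event.rare ev) (failures-rare evs) ⟩
    length orderings + length evs * length orderings         ∎
    where open ≤-Reasoning

  no-failure : ∀ {evs ev} σ → ev ∈ evs → failures evs σ ≡ 0 → Event.holds ev σ ≡ false
  no-failure {ev ∷ _} σ (here refl) eq with Event.holds ev σ
  ... | false = refl
  no-failure {ev ∷ _} σ (there ev∈) eq = no-failure σ ev∈ (m+n≡0⇒n≡0 (ind (Event.holds ev σ)) eq)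

  bad : List Ed → ℕ
  bad = failures events

  Complete : List Ed → Set
  Complete σ = ∀ e → e ∈ σ

  ordering-complete : ∀ {σ} → σ ∈ orderings → Complete σ
  ordering-complete σ∈ e = ∈-resp-↭ (↭-sym (perms-↭ allEdges σ∈)) (allEdges-complete e)

  pos-injective : ∀ {σ e e'} → e ∈ σ → e' ∈ σ → pos σ e ≡ pos σ e' → e ≡ e'
  pos-injective {x ∷ xs} {e} {e'} e∈ e'∈ eq with eqE x e in p | eqE x e' in q
  ... | true  | true  = trans (sym (eqE-sound x e p)) (eqE-sound x e' q)
  ... | false | false = pos-injective (later e∈ p) (later e'∈ q) (suc-injective eq)
    where
    later : ∀ {e} → e ∈ x ∷ xs → eqE x e ≡ false → e ∈ xs
    later (here refl) p with () ← trans (sym p) (eqE-refl x)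
    later (there e∈) p = e∈

  pos-< : ∀ {σ} → Complete σ → ∀ {e e'} → e ≢ e' → pos σ e ≤ pos σ e' → pos σ e < pos σ e'
  pos-< c ne le = ≤∧≢⇒< le λ eq → ne (pos-injective (c _) (c _) eq)

  good-order : ∀ σ → Complete σ → bad σ ≡ 0 → GoodOrder σ
  good-order σ c ok = record
    { late-u0 = λ i → late (copies-u0 i) (in-level i (here refl))
    ; late-w0 = λ i → late (copies-w0 i) (in-level i (there (here refl)))
    ; late-a0 = λ i j k → late (copies-a0 i j k) (in-level i (there (there (there
        (∈-++⁺ʳ (map (copies-wj i) (allFin f)) (∈-++⁺ʳ (map (copies-b0 i) (allFin (f * f)))
          (in-concatMap (λ j → map (copies-a0 i j) (allFin f)) j (in-map (copies-a0 i j) k))))))))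
    ; late-b0 = λ i j → late (copies-b0 i j) (in-level i (there (there (there
        (∈-++⁺ʳ (map (copies-wj i) (allFin f)) (∈-++⁺ˡ (in-map (copies-b0 i) j)))))))
    ; late-u1 = λ i → late (copies-u1 i) (in-level i (there (there (here refl))))
    ; late-wj = λ i j → late (copies-wj i j) (in-level i (there (there (there (∈-++⁺ˡ (in-map (copies-wj i) j))))))
    ; b-first = λ i → let j , j* , le = chains-late i σ (no-failure σ (in-concatMap eventsAt i (here refl)) ok) in
        j , j* , λ k → pos-< c (λ ()) (le k) }
    where
    in-level : ∀ i {γ} → γ ∈ copiesAt i → γ ∈ all-copies
    in-level i = in-concatMap copiesAt i
    -- The last copy of the bundle serves all chains at once: for each chain some copy follows one
    -- of its edges, and the last copy is no earlier.
    late : ∀ γ → γ ∈ all-copies → ∃ λ l → Late σ (Copies.copy γ l)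
    late γ γ∈ = proj₁ last , λ i j →
      let k , le = copies-late i j γ σ (no-failure σ (in-concatMap eventsAt i
                     (there (in-concatMap (λ j → map (copies-event i j) all-copies) j (∈-map⁺ (copies-event i j) γ∈)))) ok)
      in k , <-≤-trans (pos-< c (Copies.not-a1 γ ∘ sym) le) (proj₂ last k)
      where last = arg-max λ k → pos σ (Copies.copy γ k)

  initial : ∀ {σ} (good : GoodOrder σ) {B₀} → IsTree B₀ → (∀ e → B₀ e ≡ true → isZeroEdge e ≡ true) → State σ fullSet B₀ n
  initial good {B₀} tree zeros = record
    { tree = tree ; inside = λ _ _ → refl ; late = λ _ _ → refl
    ; inv = λ i _ _ → let j , j* , lt = GoodOrder.b-first good i in j , j* , (λ _ → refl) , lt
    ; reset-a = λ i _ j k p → false≢true (zeros _ p)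
    ; reset-b = λ i _ j p → false≢true (zeros _ p) }
    where false≢true : false ≢ true
          false≢true ()

  firstB : List Ed → Fin n → ℕ
  firstB σ d = minF λ j → pos σ (b1 d j)

  firstB-precedes : ∀ σ {d d'} → firstB σ d < firstB σ d' → Precedes σ d d'
  firstB-precedes σ {d} {d'} lt j' with j , eq ← minF-attained (λ j → pos σ (b1 d j)) =
    j , ≤-<-trans (≤-reflexive eq) (<-≤-trans lt (minF-≤ (λ j → pos σ (b1 d' j)) j'))

  firstB-injective : ∀ {σ} → Complete σ → ∀ {d d'} → firstB σ d ≡ firstB σ d' → d ≡ d'
  firstB-injective {σ} c {d} {d'} eq
    with j , p ← minF-attained (λ j → pos σ (b1 d j)) | j' , p' ← minF-attained (λ j → pos σ (b1 d' j))
    with refl ← pos-injective (c (b1 d j)) (c (b1 d' j')) (trans p (trans eq (sym p'))) = refl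

  Down : List Ed → Fin n → Fin n → Set
  Down σ d d' = toℕ d' < toℕ d × firstB σ d < firstB σ d'

  descending : ∀ σ {D m} → All (λ d → toℕ d < m) D → AllPairs (Down σ) D → Descending σ m D
  descending σ [] [] = []
  descending σ (d<m ∷ _) (ds ∷ rest) =
    add d<m (All.map (firstB-precedes σ ∘ proj₂) ds) (descending σ (All.map proj₁ ds) rest)

  count-chain : ∀ {σ} → Complete σ → bad σ ≡ 0 → ∀ {B₀ B' k D} → IsTree B₀ → (∀ e → B₀ e ≡ true → isZeroEdge e ≡ true) →
                RF σ fullSet B₀ B' k → AllPairs (Down σ) D → 2 ^ length D ≤ suc k
  count-chain {σ} c ok {D = D} tree zeros rf down = count σ good rf (initial good tree zeros) top
    (descending σ (All.universal (λ d → Fin.toℕ<n d) D) down) (All.universal (λ _ _ → refl) D)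
    where good = good-order σ c ok

  -- A symmetry of the uniform distribution only. Costs depend on the level, so a run on
  -- `map flipE σ` is not the mirror image of a run on σ.
  flipE : Ed → Ed
  flipE (a1 i j k)   = a1 (opposite i) j k
  flipE (a0 i j k l) = a0 (opposite i) j k l
  flipE (b1 i j)     = b1 (opposite i) j
  flipE (b0 i j l)   = b0 (opposite i) j l
  flipE (u1 i l)     = u1 (opposite i) l
  flipE (u0 i l)     = u0 (opposite i) l
  flipE (wj i j l)   = wj (opposite i) j l
  flipE (w0 i l)     = w0 (opposite i) l

  flipE-involutive : ∀ e → flipE (flipE e) ≡ e
  flipE-involutive (a1 i j k)   = cong (λ i → a1 i j k) (Fin.opposite-involutive i)
  flipE-involutive (a0 i j k l) = cong (λ i → a0 i j k l) (Fin.opposite-involutive i)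
  flipE-involutive (b1 i j)     = cong (λ i → b1 i j) (Fin.opposite-involutive i)
  flipE-involutive (b0 i j l)   = cong (λ i → b0 i j l) (Fin.opposite-involutive i)
  flipE-involutive (u1 i l)     = cong (λ i → u1 i l) (Fin.opposite-involutive i)
  flipE-involutive (u0 i l)     = cong (λ i → u0 i l) (Fin.opposite-involutive i)
  flipE-involutive (wj i j l)   = cong (λ i → wj i j l) (Fin.opposite-involutive i)
  flipE-involutive (w0 i l)     = cong (λ i → w0 i l) (Fin.opposite-involutive i)

  flip-complete : ∀ {σ} → Complete σ → Complete (map flipE σ)
  flip-complete {σ} c e = subst (_∈ map flipE σ) (flipE-involutive e) (∈-map⁺ flipE (c (flipE e)))

  firstB-flip : ∀ σ d → firstB (map flipE σ) d ≡ firstB σ (opposite d)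
  firstB-flip σ d = minF-cong λ j → pos-relabel flipE flipE-involutive σ (b1 d j)

  Up : List Ed → Fin n → Fin n → Set
  Up σ d d' = toℕ d' < toℕ d × firstB σ d' < firstB σ d

  opposite-< : ∀ {d d' : Fin n} → toℕ d' < toℕ d → toℕ (opposite d) < toℕ (opposite d')
  opposite-< {d} {d'} lt rewrite Fin.opposite-prop d | Fin.opposite-prop d' = ∸-monoʳ-< (s≤s lt) (Fin.toℕ<n d)

  reverse-pairs : ∀ {A : Set} {R : A → A → Set} {xs} → AllPairs R xs → AllPairs (flip R) (reverse xs)
  reverse-pairs [] = []
  reverse-pairs {R = R} {x ∷ xs} (rs ∷ rest) = subst (AllPairs (flip R)) (sym (unfold-reverse x xs))
    (AllPairs.++⁺ (reverse-pairs rest) ([] ∷ []) (All.map (λ r → r ∷ []) (All.tabulate λ x∈ → All.lookup rs (∈-reverse x∈))))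
    where
    ∈-reverse : ∀ {y} → y ∈ reverse xs → y ∈ xs
    ∈-reverse = ∈-resp-↭ (↭-reverse xs)

  -- `opposite` inverts the order of the levels and keeps that of the first b-edges; reversing the
  -- list then inverts both, which turns `Up` into `Down`.
  flip-chain : ∀ σ {D} → AllPairs (Up σ) D → AllPairs (Down (map flipE σ)) (reverse (map opposite D))
  flip-chain σ up = reverse-pairs (AllPairs.map⁺ (AllPairs.map flipped up))
    where
    flipped : ∀ {d d'} → Up σ d d' → Down (map flipE σ) (opposite d') (opposite d)
    flipped {d} {d'} (lt , lt') = opposite-< lt ,
      subst₂ _<_ (sym (at d')) (sym (at d)) lt'
      where at : ∀ d → firstB (map flipE σ) (opposite d) ≡ firstB σ d
            at d = trans (firstB-flip σ (opposite d)) (cong (firstB σ) (Fin.opposite-involutive d))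

  levels : List (Fin n)
  levels = tabulate opposite

  levels-pairs : ∀ {σ} → Complete σ → AllPairs (λ d d' → Down σ d d' ⊎ Up σ d d') levels
  levels-pairs {σ} c = AllPairs.tabulate⁺-< λ {i} {j} i<j → pair (opposite-< i<j)
    where
    pair : ∀ {d d'} → toℕ d' < toℕ d → Down σ d d' ⊎ Up σ d d'
    pair {d} {d'} lt with <-cmp (firstB σ d) (firstB σ d')
    ... | tri< l _ _ = inj₁ (lt , l)
    ... | tri≈ _ e _ = ⊥-elim (<-irrefl (cong toℕ (sym (firstB-injective c e))) lt)
    ... | tri> _ _ g = inj₂ (lt , g)

  module _ {B₀ : EdgeSet} (tree : IsTree B₀) (zeros : ∀ e → B₀ e ≡ true → isZeroEdge e ≡ true) where

    private
      complete? : ∀ σ → Dec (Complete σ)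
      complete? σ with All.all? (λ e → e ∈? σ) allEdges
        where open import Data.List.Membership.DecPropositional _≟E_ using (_∈?_)
      ... | yes all = yes λ e → All.lookup all (allEdges-complete e)
      ... | no ¬all = no λ c → ¬all (All.universal c allEdges)

      run : ∀ σ → Complete σ → ∃₂ λ B' k → RF σ fullSet B₀ B' k
      run σ c = RF-exists σ c fullSet B₀ tree (λ _ _ → refl)

    -- The default 0 concerns only lists that omit an edge, hence no ordering.
    switches : List Ed → ℕ
    switches σ with complete? σ
    ... | yes c = proj₁ (proj₂ (run σ c))
    ... | no _  = 0

    switches-RF : ∀ {σ} → Complete σ → ∃ λ B' → RF σ fullSet B₀ B' (switches σ)
    switches-RF {σ} c with complete? σ
    ... | yes c' = proj₁ (run σ c') , proj₂ (proj₂ (run σ c'))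
    ... | no ¬c  = ⊥-elim (¬c c)

    -- The last summand makes the bound trivial as soon as σ or its mirror image is bad, so it can
    -- be summed over all orderings without conditioning on good ones.
    pointwise : ∀ {σ} → Complete σ → ∀ m → m * m ≤ n →
                2 ^ m ≤ 1 + (switches σ + switches (map flipE σ)) + 2 ^ m * (bad σ + bad (map flipE σ))
    pointwise {σ} c m m²≤n with bad σ in p | bad (map flipE σ) in q
    ... | suc x | y = ≤-trans (m≤m*n (2 ^ m) (suc x + y)) (m≤n+m _ _)
    ... | zero | suc y = ≤-trans (m≤m*n (2 ^ m) (suc y)) (m≤n+m _ _)
    ... | zero | zero with monochromatic-chain m levels (≤-trans m²≤n (≤-reflexive (sym (length-tabulate opposite)))) (levels-pairs c)
      where open ErdősSzekeres {R = Down σ} {Up σ} (λ (lt , p) (lt' , p') → <-trans lt' lt , <-trans p p') (λ (lt , p) (lt' , p') → <-trans lt' lt , <-trans p' p)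
    ...   | D , m≤ , inj₁ down = ≤-trans (^-monoʳ-≤ 2 m≤) (≤-trans
            (count-chain c p tree zeros (proj₂ (switches-RF c)) down)
            (≤-trans (s≤s (m≤m+n _ _)) (m≤m+n _ _)))
    ...   | D , m≤ , inj₂ up = ≤-trans (^-monoʳ-≤ 2 (≤-trans m≤ (≤-reflexive (sym len)))) (≤-trans
            (count-chain (flip-complete c) q tree zeros (proj₂ (switches-RF (flip-complete c))) (flip-chain σ up))
            (≤-trans (s≤s (m≤n+m _ (switches σ))) (m≤m+n _ _)))
      where len : length (reverse (map opposite D)) ≡ length D
            len = trans (length-reverse (map opposite D)) (length-map opposite D)

    average : ∀ m → m * m ≤ n →
              2 ^ m * length orderings ≤ length orderings + 2 * # switches + 2 ^ m * (2 * # bad)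
    average m m²≤n = begin
      2 ^ m * length orderings                       ≡⟨ *-comm (2 ^ m) _ ⟩
      length orderings * 2 ^ m                       ≡⟨ sym (sum-map-const (2 ^ m) orderings) ⟩
      # (λ _ → 2 ^ m)                                ≤⟨ sum-map-∈ orderings (λ σ σ∈ → pointwise (ordering-complete σ∈) m m²≤n) ⟩
      # (λ σ → 1 + (switches σ + switches (map flipE σ)) + 2 ^ m * (bad σ + bad (map flipE σ)))
                                                     ≡⟨ split ⟩
      length orderings + 2 * # switches + 2 ^ m * (2 * # bad) ∎
      where
      open ≤-Reasoning
      sum-map-∈ : ∀ {F G : List Ed → ℕ} xs → (∀ σ → σ ∈ xs → F σ ≤ G σ) → sum (map F xs) ≤ sum (map G xs)
      sum-map-∈ [] le = z≤n
      sum-map-∈ (x ∷ xs) le = +-mono-≤ (le x (here refl)) (sum-map-∈ xs λ σ σ∈ → le σ (there σ∈))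
      sum-map-* : ∀ c (F : List Ed → ℕ) xs → sum (map (λ x → c * F x) xs) ≡ c * sum (map F xs)
      sum-map-* c F [] = sym (*-zeroʳ c)
      sum-map-* c F (x ∷ xs) = trans (cong (c * F x +_) (sum-map-* c F xs)) (sym (*-distribˡ-+ c (F x) _))
      twice : ∀ F → # (λ σ → F σ + F (map flipE σ)) ≡ 2 * # F
      twice F = trans (sum-map-+ F (F ∘ map flipE) orderings)
        (cong (# F +_) (trans (#-relabel flipE flipE-involutive F) (sym (+-identityʳ _))))
      split : _ ≡ _
      split = trans (sum-map-+ (λ σ → 1 + (switches σ + switches (map flipE σ))) (λ σ → 2 ^ m * (bad σ + bad (map flipE σ))) orderings)
        (cong₂ _+_ (trans (sum-map-+ (λ _ → 1) (λ σ → switches σ + switches (map flipE σ)) orderings)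
                     (cong₂ _+_ (trans (sum-map-const 1 orderings) (*-identityʳ (length orderings))) (twice switches)))
                   (trans (sum-map-* (2 ^ m) (λ σ → bad σ + bad (map flipE σ)) orderings) (cong (2 ^ m *_) (twice bad))))

-- Numerical estimates

n<2^1+log : ∀ n → n < 2 ^ suc ⌊log₂ n ⌋
n<2^1+log n = ≰⇒> λ le → <-irrefl refl
  (≤-trans (≤-reflexive (sym (⌊log₂[2^n]⌋≡n (suc ⌊log₂ n ⌋)))) (⌊log₂⌋-mono-≤ le))

2^≤⇒≤log : ∀ k {n} → 2 ^ k ≤ n → k ≤ ⌊log₂ n ⌋
2^≤⇒≤log k le = ≤-trans (≤-reflexive (sym (⌊log₂[2^n]⌋≡n k))) (⌊log₂⌋-mono-≤ le)

m≤2^m : ∀ m → m ≤ 2 ^ m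
m≤2^m zero = z≤n
m≤2^m (suc m) = ≤-trans (+-mono-≤ (m^n>0 2 m) (m≤2^m m)) (≤-reflexive (cong (2 ^ m +_) (sym (+-identityʳ _))))

-- Every factor is rounded up to a power of two, even `f` to `2 ^ (5 + L)`. The exponents add up to
-- `24 + 5 * L`, which is at most `1 + 16 * L` once `23 ≤ 11 * L`.
few-events : ∀ n L → n < 2 ^ suc L → 3 ≤ L →
  8 * (n * (1 + suc (16 * L) * (n * (3 + (suc (16 * L) + (suc (16 * L) * suc (16 * L) + suc (16 * L) * suc (16 * L))))))) ≤ 2 ^ suc (16 * L)
few-events n L n<2^ 3≤L = begin
  8 * (n * (1 + f * (n * (3 + (f + (f * f + f * f))))))  ≤⟨ *-monoʳ-≤ 8 (mul (suc L) (suc (5 + L + (suc L + X))) (<⇒≤ n<2^) (plus (5 + L + (suc L + X))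
                           (mul (5 + L) (suc L + X) f≤ (mul (suc L) X (<⇒≤ n<2^) square)))) ⟩
  2 ^ 3 * 2 ^ (suc L + suc ((5 + L) + (suc L + X)))
                       ≡⟨ sym (^-distribˡ-+-* 2 3 (suc L + suc ((5 + L) + (suc L + X)))) ⟩
  2 ^ (3 + (suc L + suc ((5 + L) + (suc L + X))))
                       ≤⟨ ^-monoʳ-≤ 2 (≤-trans (≤-reflexive collect) (≤-trans (+-monoˡ-≤ (1 + 5 * L) (≤-trans (m≤m+n 23 10) (*-monoʳ-≤ 11 3≤L))) (≤-reflexive collect'))) ⟩
  2 ^ suc (16 * L)     ∎
  where
  open ≤-Reasoning
  open +-*-Solver
  f = suc (16 * L)
  X = 3 + ((5 + L) + (5 + L))
  collect : 3 + (suc L + suc ((5 + L) + (suc L + (3 + ((5 + L) + (5 + L)))))) ≡ 23 + (1 + 5 * L)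
  collect = solve 1 (λ L → con 3 :+ (con 1 :+ L :+ (con 1 :+ ((con 5 :+ L) :+ (con 1 :+ L :+ (con 3 :+ ((con 5 :+ L) :+ (con 5 :+ L))))))) := con 23 :+ (con 1 :+ con 5 :* L)) refl L
  collect' : 11 * L + (1 + 5 * L) ≡ suc (16 * L)
  collect' = solve 1 (λ L → con 11 :* L :+ (con 1 :+ con 5 :* L) := con 1 :+ con 16 :* L) refl L
  mul : ∀ {x y} p q → x ≤ 2 ^ p → y ≤ 2 ^ q → x * y ≤ 2 ^ (p + q)
  mul p q le le' = ≤-trans (*-mono-≤ le le') (≤-reflexive (sym (^-distribˡ-+-* 2 p q)))
  plus : ∀ {x} p → x ≤ 2 ^ p → 1 + x ≤ 2 ^ suc p
  plus p le = ≤-trans (+-mono-≤ (m^n>0 2 p) le) (≤-reflexive (cong (2 ^ p +_) (sym (+-identityʳ _))))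
  f≤ : f ≤ 2 ^ (5 + L)
  f≤ = begin
    1 + 16 * L     ≤⟨ +-monoˡ-≤ (16 * L) (≤-trans (s≤s z≤n) 3≤L) ⟩
    L + 16 * L     ≤⟨ *-monoˡ-≤ L (m≤m+n 17 15) ⟩
    32 * L         ≤⟨ *-monoʳ-≤ 32 (m≤2^m L) ⟩
    2 ^ 5 * 2 ^ L  ≡⟨ sym (^-distribˡ-+-* 2 5 L) ⟩
    2 ^ (5 + L)    ∎
  square : 3 + (f + (f * f + f * f)) ≤ 2 ^ (3 + ((5 + L) + (5 + L)))
  square = begin
    3 + (f + (f * f + f * f))         ≤⟨ +-mono-≤ (*-monoʳ-≤ 3 1≤ff) (+-monoˡ-≤ (f * f + f * f) (m≤m*n f f)) ⟩
    3 * (f * f) + (f * f + (f * f + f * f)) ≡⟨ solve 1 (λ x → con 3 :* x :+ (x :+ (x :+ x)) := con 6 :* x) refl (f * f) ⟩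
    6 * (f * f)                       ≤⟨ *-mono-≤ (m≤m+n 6 2) (mul (5 + L) (5 + L) f≤ f≤) ⟩
    2 ^ 3 * 2 ^ ((5 + L) + (5 + L))   ≡⟨ sym (^-distribˡ-+-* 2 3 ((5 + L) + (5 + L))) ⟩
    2 ^ (3 + ((5 + L) + (5 + L)))     ∎
    where 1≤ff : 1 ≤ f * f
          1≤ff = s≤s z≤n

-- The union bound gives `8 * T ≤ Ω`, so failures take away at most a quarter of `P * Ω`. The
-- remaining three quarters are at least `24 * h * Ω`, of which the single Ω on the right is a small
-- part.
conclude : ∀ {P h E F Ω C T} → 32 * h ≤ P → 1 ≤ h → 1 ≤ F → F * T ≤ E * Ω → 8 * E ≤ F →
           P * Ω ≤ Ω + 2 * C + P * (2 * T) → h * Ω ≤ C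
conclude {P} {h} {E} {F@(suc _)} {Ω} {C} {T} 32h≤P 1≤h _ FT≤EΩ 8E≤F avg =
  *-cancelˡ-≤ 8 (≤-trans (*-monoˡ-≤ (h * Ω) (m≤m+n 8 84)) (+-cancelˡ-≤ (4 * (h * Ω)) _ _ (begin
    4 * (h * Ω) + 92 * (h * Ω)   ≡⟨ solve 2 (λ h Ω → con 4 :* (h :* Ω) :+ con 92 :* (h :* Ω) := con 3 :* (con 32 :* h :* Ω)) refl h Ω ⟩
    3 * (32 * h * Ω)             ≤⟨ *-monoʳ-≤ 3 (*-monoˡ-≤ Ω 32h≤P) ⟩
    3 * (P * Ω)                  ≤⟨ +-cancelˡ-≤ (P * Ω) _ _ core ⟩
    4 * Ω + 8 * C                ≤⟨ +-monoˡ-≤ (8 * C) (*-monoʳ-≤ 4 (≤-trans (≤-reflexive (sym (*-identityˡ Ω))) (*-monoˡ-≤ Ω 1≤h))) ⟩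
    4 * (h * Ω) + 8 * C          ∎)))
  where
  open ≤-Reasoning
  open +-*-Solver
  8T≤Ω : 8 * T ≤ Ω
  8T≤Ω = *-cancelˡ-≤ F (begin
    F * (8 * T)   ≡⟨ solve 2 (λ F T → F :* (con 8 :* T) := con 8 :* (F :* T)) refl F T ⟩
    8 * (F * T)   ≤⟨ *-monoʳ-≤ 8 FT≤EΩ ⟩
    8 * (E * Ω)   ≡⟨ sym (*-assoc 8 E Ω) ⟩
    8 * E * Ω     ≤⟨ *-monoˡ-≤ Ω 8E≤F ⟩
    F * Ω         ∎)
  core : P * Ω + 3 * (P * Ω) ≤ P * Ω + (4 * Ω + 8 * C)
  core = begin
    P * Ω + 3 * (P * Ω)                     ≡⟨ solve 1 (λ x → x :+ con 3 :* x := con 4 :* x) refl (P * Ω) ⟩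
    4 * (P * Ω)                             ≤⟨ *-monoʳ-≤ 4 avg ⟩
    4 * (Ω + 2 * C + P * (2 * T))           ≡⟨ solve 4 (λ Ω C P T → con 4 :* (Ω :+ con 2 :* C :+ P :* (con 2 :* T)) := P :* (con 8 :* T) :+ (con 4 :* Ω :+ con 8 :* C)) refl Ω C P T ⟩
    P * (8 * T) + (4 * Ω + 8 * C)           ≤⟨ +-monoˡ-≤ (4 * Ω + 8 * C) (*-monoʳ-≤ P 8T≤Ω) ⟩
    P * Ω + (4 * Ω + 8 * C)                 ∎

-- Choice of the parameters and the final estimate

mainTheorem2 : Σ (ℕ → ℕ) λ f → Σ (∀ n → NonZero (f n)) λ f≢0 →
    (∃₂ λ c n₁ → ∀ n → n₁ ≤ n → (⌊log₂ n ⌋ ≤ c * f n) × (f n ≤ c * ⌊log₂ n ⌋)) ×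
    (∃₂ λ k n₀ → ∀ n → n₀ ≤ n →
    let open Graph n (f n) (f n) (f n) {{f≢0 n}} {{f≢0 n}} in
    ∀ (B₀ : EdgeSet) → IsTree B₀ → (∀ e → B₀ e ≡ true → isZeroEdge e ≡ true) →
    Σ (List Ed → ℕ) λ cnt →
    (∀ ord → ord ∈ orderings → ∃ λ B' → RF ord fullSet B₀ B' (cnt ord)) ×
    (∀ m → m * m ≤ n → 2 ^ (m / suc k) * length orderings ≤ sum (map cnt orderings)))
mainTheorem2 = width , (λ _ → _) , (17 , 2 , log-bounds) , 1 , 100 , bound
  where
  -- The factor 16 leaves `2 ^ width n` above eight times the number of events, a polynomial in n
  -- and log n; the `suc` keeps the width positive for every n.
  width : ℕ → ℕ
  width n = suc (16 * ⌊log₂ n ⌋)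

  log-bounds : ∀ n → 2 ≤ n → (⌊log₂ n ⌋ ≤ 17 * width n) × (width n ≤ 17 * ⌊log₂ n ⌋)
  log-bounds n 2≤n = ≤-trans (≤-trans (m≤n*m L 16) (n≤1+n _)) (m≤n*m (width n) 17)
                   , +-monoˡ-≤ (16 * L) (2^≤⇒≤log 1 2≤n)
    where L = ⌊log₂ n ⌋

  bound : ∀ n → 100 ≤ n → _
  bound n 100≤n B₀ tree zeros = switches tree zeros , (λ ord ord∈ → switches-RF tree zeros (ordering-complete ord∈)) , lower
    where
    L = ⌊log₂ n ⌋
    open Average n (16 * L)
    few : 8 * length events ≤ 2 ^ width n
    few = subst (λ x → 8 * x ≤ 2 ^ width n) (sym length-events)
      (few-events n L (n<2^1+log n) (2^≤⇒≤log 3 (≤-trans (m≤m+n 8 92) 100≤n)))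
    lower : ∀ m → m * m ≤ n → 2 ^ (m / 2) * length orderings ≤ # switches tree zeros
    lower m m²≤n = conclude {P = 2 ^ M} {E = length events} (≤-trans (≤-reflexive (sym (^-distribˡ-+-* 2 5 (m / 2)))) (^-monoʳ-≤ 2 exponent))
      (m^n>0 2 (m / 2)) (m^n>0 2 (width n)) (failures-rare events) few (average tree zeros M M²≤n)
      where
      -- Halving the exponent leaves room for the factor `32 = 2 ^ 5` required by `conclude` once
      -- the exponent is at least 10. This is why n starts at `100 = 10 * 10`.
      M = m ⊔ 10
      M²≤n : M * M ≤ n
      M²≤n with ⊔-sel m 10
      ... | inj₁ eq = subst (λ x → x * x ≤ n) (sym eq) m²≤n
      ... | inj₂ eq = subst (λ x → x * x ≤ n) (sym eq) 100≤n
      exponent : 5 + m / 2 ≤ M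
      exponent = *-cancelˡ-≤ 2 (begin
        2 * (5 + m / 2)   ≡⟨ solve 1 (λ x → con 2 :* (con 5 :+ x) := con 10 :+ x :* con 2) refl (m / 2) ⟩
        10 + m / 2 * 2    ≤⟨ +-mono-≤ (m≤n⊔m m 10) (≤-trans (m/n*n≤m m 2) (m≤m⊔n m 10)) ⟩
        M + M             ≡⟨ cong (M +_) (sym (+-identityʳ M)) ⟩
        2 * M             ∎)
        where open ≤-Reasoning
              open +-*-Solver
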